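{- Let $N$ and $\nu$ be positive integers. Then, as formal power series in $q$, $$\sum_{n=1}^{\infty}\mu_{2\nu,N}(n)q^n=(q)_N\sum_{n=1}^{N}\frac{(-1)^{n-1}q^{\frac{n(n-1)}{2}+\nu n}(1+q^n)}{(q)_{N+n}(q)_{N-n}(1-q^n)^{2\nu}}=(q)_N\sum_{\substack{n=-N\\ n\ne 0}}^{N}\frac{(-1)^{n-1}q^{\frac{n(n+1)}{2}+\nu n}}{(q)_{N+n}(q)_{N-n}(1-q^n)^{2\nu}},$$ where $\mu_{2\nu,N}(n):=\sum_{m=-n}^{n}\binom{m+\nu-1}{2\nu}M_{S_2}(m,n)$.
   Context: $(a)_n=(a;q)_n=\prod_{i=0}^{n-1}(1-aq^i)$, $(a)_0=1$. Here $\binom{x}{k}=\frac{x(x-1)\cdots(x-k+1)}{k!}$ for any integer $x$. For a partition $\pi$, $|\pi|$ is the sum of its parts, $\#(\pi)$ its number of parts, and $l(\pi)$ its largest part ($0$ if empty). Let $S_2$ be the set of triples $\vec\pi=(\pi_1,\pi_2,\pi_3)$ where $\pi_1$ is a partition into distinct parts and $\pi_2,\pi_3$ are partitions (all possibly empty), with $l(\pi_1),l(\pi_2),l(\pi_3)\le N$. Set $|\vec\pi|=|\pi_1|+|\pi_2|+|\pi_3|$, weight $w_c(\vec\pi)=(-1)^{\#(\pi_1)}$ and $\mathrm{crank}(\vec\pi)=\#(\pi_2)-\#(\pi_3)$. Define $M_{S_2}(m,n)=\sum_{\vec\pi\in S_2,\ |\vec\pi|=n,\ \mathrm{crank}(\vec\pi)=m}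 w_c(\vec\pi)$. -}

module Defs where

open import Data.Nat as ℕ using (ℕ; zero; suc; _!; _≤ᵇ_; _≡ᵇ_)
open import Data.Nat.Properties using (_!≢0)
open import Data.Integer as ℤ using (ℤ; +_; -[1+_]; _/ℕ_; ∣_∣)
open import Data.List using (List; []; _∷_; _++_; map; concatMap; upTo; replicate; length; foldr; filter; applyUpTo)
open import Data.Product using (_×_; _,_)
open import Data.Bool using (Bool; true; false; if_then_else_)
open import Relation.Nullary.Decidable using (does)

-- Partitions (as nonincreasing lists of positive parts)

partsLE : ℕ → ℕ → List (List ℕ)
partsLE zero zero = [] ∷ []
partsLE zero (suc _) = []
partsLE (suc k) n =
  concatMap (λ c → if (c ℕ.* suc k) ≤ᵇ n
                   then map (replicate c (suc k) ++_) (partsLE k (n ℕ.∸ (c ℕ.* suc k)))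
                   else [])
            (upTo (suc n))

distinctLE : ℕ → ℕ → List (List ℕ)
distinctLE zero zero = [] ∷ []
distinctLE zero (suc _) = []
distinctLE (suc k) n =
  distinctLE k n ++
  (if suc k ≤ᵇ n then map (suc k ∷_) (distinctLE k (n ℕ.∸ suc k)) else [])

Triple : Set
Triple = List ℕ × List ℕ × List ℕ

S₂ : (N n : ℕ) → List Triple
S₂ N n =
  concatMap (λ n₁ →
    concatMap (λ n₂ →
      concatMap (λ π₁ →
        concatMap (λ π₂ →
          map (λ π₃ → (π₁ , π₂ , π₃)) (partsLE N (n ℕ.∸ n₁ ℕ.∸ n₂)))
          (partsLE N n₂))
        (distinctLE N n₁))
      (upTo (suc (n ℕ.∸ n₁))))
    (upTo (suc n))

sgn : ℕ → ℤ
sgn zero = + 1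
sgn (suc k) = ℤ.- sgn k

weight : Triple → ℤ
weight (π₁ , _ , _) = sgn (length π₁)

crank : Triple → ℤ
crank (_ , π₂ , π₃) = + length π₂ ℤ.- + length π₃

sumℤ : List ℤ → ℤ
sumℤ = foldr ℤ._+_ (+ 0)

M-S₂ : (N : ℕ) → ℤ → ℕ → ℤ
M-S₂ N m n = sumℤ (map (λ t → if does (crank t ℤ.≟ m) then weight t else + 0) (S₂ N n))

falling : ℤ → ℕ → ℤ
falling x zero = + 1
falling x (suc k) = falling x k ℤ.* (x ℤ.- + k)

binomℤ : ℤ → ℕ → ℤ
binomℤ x k = _/ℕ_ (falling x k) (k !) {{k !≢0}}

rangeℤ : ℤ → ℤ → List ℤ
rangeℤ a b = applyUpTo (λ i → a ℤ.+ + i) ∣ (b ℤ.+ + 1) ℤ.- a ∣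

μ : (ν N n : ℕ) → ℤ
μ ν N n = sumℤ (map (λ m → binomℤ (m ℤ.+ + ν ℤ.- + 1) (2 ℕ.* ν) ℤ.* M-S₂ N m n)
                    (rangeℤ (ℤ.- + n) (+ n)))

PS : Set
PS = ℕ → ℤ

sumTo : ℕ → (ℕ → ℤ) → ℤ
sumTo zero f = f zero
sumTo (suc n) f = sumTo n f ℤ.+ f (suc n)

_⊕_ : PS → PS → PS
(f ⊕ g) n = f n ℤ.+ g n

_⊗_ : PS → PS → PS
(f ⊗ g) n = sumTo n (λ i → f i ℤ.* g (n ℕ.∸ i))

infixl 6 _⊕_
infixl 7 _⊗_

cst : ℤ → PS
cst c zero = c
cst c (suc _) = + 0

zeroPS : PS
zeroPS _ = + 0

mono : ℕ → PS
mono e n = if e ≡ᵇ n then + 1 else + 0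

_^PS_ : PS → ℕ → PS
f ^PS zero = cst (+ 1)
f ^PS suc k = f ⊗ (f ^PS k)

qpoch : ℕ → PS
qpoch zero = cst (+ 1)
qpoch (suc n) = qpoch n ⊗ (cst (+ 1) ⊕ cst (ℤ.- + 1) ⊗ mono (suc n))

oneMinusQ : ℕ → PS
oneMinusQ k = cst (+ 1) ⊕ cst (ℤ.- + 1) ⊗ mono k

-- multiplicative inverse of a power series with constant term 1:
-- b 0 = 1,  b n = - Σ_{k=1}^{n} a k * b (n-k)
-- invUpTo a n agrees with the inverse at all indices ≤ n (0 beyond)
invUpTo : PS → ℕ → PS
invUpTo a zero i = cst (+ 1) i
invUpTo a (suc n) i =
  if i ≤ᵇ n then invUpTo a n i
  else (if i ≡ᵇ suc n
        then ℤ.- sumTo n (λ j → a (suc j) ℤ.* invUpTo a n (n ℕ.∸ j))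
        else + 0)

inv : PS → PS
inv a i = invUpTo a i i

ΣPS : ℕ → (ℕ → PS) → PS
ΣPS zero f = zeroPS
ΣPS (suc N) f = ΣPS N f ⊕ f (suc N)

-- Laurent series with integer exponents, as coefficient functions ℤ → ℤ
-- (only used with finitely many terms, each a monomial times a power series)

LS : Set
LS = ℤ → ℤ

embed : PS → LS
embed f (+ n) = f n
embed f -[1+ _ ] = + 0

shift : ℤ → LS → LS
shift e f i = f (i ℤ.- e)

_⊕L_ : LS → LS → LS
(f ⊕L g) i = f i ℤ.+ g i

zeroLS : LS
zeroLS _ = + 0

sumLS : List LS → LS
sumLS = foldr _⊕L_ zeroLS

lhsSeries : (ν N : ℕ) → PS
lhsSeries ν N zero = + 0
lhsSeries ν N (suc n) = μ ν N (suc n)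

middleSeries : (ν N : ℕ) → PS
middleSeries ν N =
  qpoch N ⊗ ΣPS N (λ n →
    cst (sgn (n ℕ.∸ 1)) ⊗ mono (ℕ._/_ (n ℕ.* (n ℕ.∸ 1)) 2 ℕ.+ ν ℕ.* n)
      ⊗ (cst (+ 1) ⊕ mono n)
      ⊗ inv (qpoch (N ℕ.+ n)) ⊗ inv (qpoch (N ℕ.∸ n))
      ⊗ inv (oneMinusQ n ^PS (2 ℕ.* ν)))

sgnℤ : ℤ → ℤ
sgnℤ n = sgn ∣ n ℤ.- + 1 ∣

rightTerm : (ν N : ℕ) → ℤ → LS
rightTerm ν N n =
  shift ((n ℤ.* (n ℤ.+ + 1)) ℤ./ℕ 2 ℤ.+ + ν ℤ.* n)
    (λ i → sumLSmul i)
  where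
  A : PS
  A = qpoch N ⊗ cst (sgnℤ n) ⊗ inv (qpoch ∣ + N ℤ.+ n ∣) ⊗ inv (qpoch ∣ + N ℤ.- n ∣)
  sumLSmul : ℤ → ℤ
  sumLSmul = helper n
    where
    -- for n < 0:  1 - q^n = -q^n (1 - q^{-n}), hence
    -- (1-q^n)^{-2ν} = q^{-2νn} (1-q^{-n})^{-2ν}  in ℤ((q))
    helper : ℤ → LS
    helper (+ k) = embed (A ⊗ inv (oneMinusQ k ^PS (2 ℕ.* ν)))
    helper -[1+ k ] = shift (+ (2 ℕ.* ν ℕ.* suc k)) (embed (A ⊗ inv (oneMinusQ (suc k) ^PS (2 ℕ.* ν))))

nonzeroRange : ℕ → List ℤ
nonzeroRange N = filter (λ n → Relation.Nullary.Decidable.¬? (n ℤ.≟ + 0)) (rangeℤ (ℤ.- + N) (+ N))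

rightSeries : (ν N : ℕ) → LS
rightSeries ν N = sumLS (map (rightTerm ν N) (nonzeroRange N))

{-# OPTIONS --safe #-}
module Submission where

-- Let K_N(m) be the coefficient of zᵐ in 1/((zq)_N (q/z)_N), so that M_{S₂}(m, ·) has
-- generating function (q)_N K_N(m).  With Q = q^N, clearing the last two factors gives
--   (1 + Q²) K_N(m) = K_{N-1}(m) + Q (K_N(m-1) + K_N(m+1)),
-- which determines K_N from K_{N-1} because multiplication by Q is q-adically contracting.
-- The partial fraction expansion
--   d_N(m) = Σ_{n=1}^N (-1)^{n-1} q^{n(n-1)/2 + n|m|} (1 - qⁿ) / ((q)_{N+n} (q)_{N-n})
-- satisfies the same recurrence: term by term if m ≠ 0, since
-- 1 + Q² - Q(qⁿ + q⁻ⁿ) = (1 - q^{N-n})(1 - q^{N+n}), and up to a telescoping sum if m = 0.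
-- Finally Σ_m (C(m+ν-1, 2ν) + C(m+ν, 2ν)) xᵐ = x^ν (1 + x) / (1 - x)^{2ν+1} at x = qⁿ, where
-- C(m+ν, 2ν) = C(-m+ν-1, 2ν) accounts for the negative cranks.

open import Defs
open import Algebra.Bundles using (CommutativeRing)
import Algebra.Solver.Ring as RingSolver
open import Algebra.Solver.Ring.AlmostCommutativeRing using (AlmostCommutativeRing; fromCommutativeRing; _-Raw-AlmostCommutative⟶_; Induced-equivalence)
open import Data.Bool using (true; false; if_then_else_)
open import Data.Empty using (⊥-elim)
open import Data.Integer as ℤ using (ℤ; +_; -[1+_])
import Data.Integer.Properties as ℤₚ
import Data.Integer.Solver as ℤSolver
open import Data.List using (List; []; _∷_; _++_; map; concatMap; upTo; replicate; length; applyUpTo; filter)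
open import Data.List.Properties using (map-∘; map-cong; length-++; length-replicate)
open import Data.Maybe using (just; nothing)
open import Data.Nat as ℕ using (ℕ; zero; suc; NonZero; _≤_; _<_; z≤n; s≤s; _≡ᵇ_; _≤ᵇ_; _!)
import Data.Nat.DivMod as DivMod
import Data.Nat.Properties as ℕₚ
import Data.Nat.Solver as ℕSolver
open import Data.Product using (_×_; _,_)
open import Data.Unit using (tt)
open import Function using (_∘_; id; flip)
open import Relation.Binary.Definitions using (WeaklyDecidable)
open import Relation.Binary.PropositionalEquality using (_≡_; refl; sym; trans; cong; cong₂; module ≡-Reasoning)
import Relation.Binary.Reasoning.Setoid as SetoidReasoning
open import Relation.Nullary using (yes; no; ¬_)
open import Relation.Nullary.Decidable using (does; dec-true; dec-false; ¬?)
open import Relation.Unary using (Decidable)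

-- Power series

-- The partial fractions are verified, not derived: no series in z occurs. A family indexed by m
-- stands for its generating function in z, and the relation between neighbours is (1 - zQ)(1 - Q/z)
-- = 1 + Q² - Q(z + 1/z) read coefficientwise. The delicate point is m = 0: the candidate depends on
-- |m| only, so both neighbours of 0 have the value at 1, and the cancellation valid for m ≠ 0
-- leaves a defect. The defects add up to 0 in a step from N ≥ 1, but to 1 in the step from N = 0,
-- where they replace the constant K_0(0) = 1 that the empty sum d_0(0) misses. The closed form
-- therefore starts at N = 1. In the passage to moments, the factor 1 - qⁿ of each partial fraction
-- lowers the exponent 2ν + 1 to 2ν, and divisibility of d_N(m) by qᵐ reconciles the finite range of
-- m in each coefficient with an infinite sum. The second equality pairs the terms n and -n of the
-- bilateral sum, whose ratio qⁿ yields the factor 1 + qⁿ.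

module ZS = ℤSolver.+-*-Solver

sumTo-cong≤ : ∀ n {f g : ℕ → ℤ} → (∀ i → i ≤ n → f i ≡ g i) → sumTo n f ≡ sumTo n g
sumTo-cong≤ zero h = h 0 z≤n
sumTo-cong≤ (suc n) h =
  cong₂ ℤ._+_ (sumTo-cong≤ n (λ i i≤n → h i (ℕₚ.m≤n⇒m≤1+n i≤n))) (h (suc n) ℕₚ.≤-refl)

sumTo-cong : ∀ n {f g : ℕ → ℤ} → (∀ i → f i ≡ g i) → sumTo n f ≡ sumTo n g
sumTo-cong n h = sumTo-cong≤ n (λ i _ → h i)

sumTo-zero : ∀ n {f : ℕ → ℤ} → (∀ i → i ≤ n → f i ≡ + 0) → sumTo n f ≡ + 0
sumTo-zero zero h = h 0 z≤n
sumTo-zero (suc n) h =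
  cong₂ ℤ._+_ (sumTo-zero n (λ i i≤n → h i (ℕₚ.m≤n⇒m≤1+n i≤n))) (h (suc n) ℕₚ.≤-refl)

sumTo-+ : ∀ n (f g : ℕ → ℤ) → sumTo n (λ i → f i ℤ.+ g i) ≡ sumTo n f ℤ.+ sumTo n g
sumTo-+ zero f g = refl
sumTo-+ (suc n) f g rewrite sumTo-+ n f g =
  ZS.solve 4 (λ a b c d → (a :+ b) :+ (c :+ d) := (a :+ c) :+ (b :+ d)) refl
    (sumTo n f) (sumTo n g) (f (suc n)) (g (suc n))
  where open ZS

sumTo-*ˡ : ∀ n c (f : ℕ → ℤ) → sumTo n (λ i → c ℤ.* f i) ≡ c ℤ.* sumTo n f
sumTo-*ˡ zero c f = refl
sumTo-*ˡ (suc n) c f rewrite sumTo-*ˡ n c f = sym (ℤₚ.*-distribˡ-+ c (sumTo n f) (f (suc n)))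

sumTo-head : ∀ n (f : ℕ → ℤ) → sumTo (suc n) f ≡ f 0 ℤ.+ sumTo n (λ i → f (suc i))
sumTo-head zero f = refl
sumTo-head (suc n) f rewrite sumTo-head n f = ℤₚ.+-assoc (f 0) _ _

sumTo-swap : ∀ n k (f : ℕ → ℕ → ℤ) →
  sumTo n (λ i → sumTo k (f i)) ≡ sumTo k (λ j → sumTo n (λ i → f i j))
sumTo-swap zero k f = refl
sumTo-swap (suc n) k f rewrite sumTo-swap n k f =
  sym (sumTo-+ k (λ j → sumTo n (λ i → f i j)) (f (suc n)))

sumTo-extend : ∀ {k n} (f : ℕ → ℤ) → k ≤ n → (∀ i → k < i → f i ≡ + 0) → sumTo n f ≡ sumTo k f
sumTo-extend {k} {n} f k≤n h = go n k≤n
  where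
  go : ∀ n → k ≤ n → sumTo n f ≡ sumTo k f
  go n k≤n with k ℕ.≟ n
  ... | yes refl = refl
  go zero z≤n | no k≢0 = ⊥-elim (k≢0 refl)
  go (suc n) k≤n | no k≢n =
    trans (cong₂ ℤ._+_ (go n (ℕ.s≤s⁻¹ (ℕₚ.≤∧≢⇒< k≤n k≢n))) (h (suc n) (ℕₚ.≤∧≢⇒< k≤n k≢n)))
          (ℤₚ.+-identityʳ _)

infix 4 _≈_

-- A record, so that the solver and unification never unfold series into coefficients.
record _≈_ (f g : PS) : Set where
  constructor mk
  field at : ∀ n → f n ≡ g n
open _≈_ public

≈-refl : ∀ {f} → f ≈ f
≈-refl = mk λ _ → refl

≈-reflexive : ∀ {f g} → f ≡ g → f ≈ g
≈-reflexive refl = ≈-refl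

≈-sym : ∀ {f g} → f ≈ g → g ≈ f
≈-sym p = mk λ n → sym (at p n)

≈-trans : ∀ {f g h} → f ≈ g → g ≈ h → f ≈ h
≈-trans p q = mk λ n → trans (at p n) (at q n)

tail : PS → PS
tail f n = f (suc n)

-- Splitting off one end of the convolution leaves another product, so commutativity and
-- associativity go by induction on the index instead of reindexing double sums.
⊗-suc : ∀ f g n → (f ⊗ g) (suc n) ≡ f 0 ℤ.* g (suc n) ℤ.+ (tail f ⊗ g) n
⊗-suc f g n = sumTo-head n _

⊗-sucʳ : ∀ f g n → (f ⊗ g) (suc n) ≡ (f ⊗ tail g) n ℤ.+ f (suc n) ℤ.* g 0
⊗-sucʳ f g n = cong₂ ℤ._+_
  (sumTo-cong≤ n (λ i i≤n → cong (λ k → f i ℤ.* g k) (ℕₚ.+-∸-assoc 1 i≤n)))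
  (cong (λ k → f (suc n) ℤ.* g k) (ℕₚ.n∸n≡0 (suc n)))

⊗-cong : ∀ {f f′ g g′} → f ≈ f′ → g ≈ g′ → f ⊗ g ≈ f′ ⊗ g′
⊗-cong p r = mk λ n → sumTo-cong n (λ i → cong₂ ℤ._*_ (at p i) (at r (n ℕ.∸ i)))

⊕-cong : ∀ {f f′ g g′} → f ≈ f′ → g ≈ g′ → f ⊕ g ≈ f′ ⊕ g′
⊕-cong p r = mk λ n → cong₂ ℤ._+_ (at p n) (at r n)

⊗-comm : ∀ f g → f ⊗ g ≈ g ⊗ f
⊗-comm f g = mk (go f g)
  where
  go : ∀ f g n → (f ⊗ g) n ≡ (g ⊗ f) n
  go f g zero = ℤₚ.*-comm (f 0) (g 0)
  go f g (suc n) = begin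
    (f ⊗ g) (suc n)                         ≡⟨ ⊗-sucʳ f g n ⟩
    (f ⊗ tail g) n ℤ.+ f (suc n) ℤ.* g 0    ≡⟨ cong₂ ℤ._+_ (go f (tail g) n) (ℤₚ.*-comm (f (suc n)) (g 0)) ⟩
    (tail g ⊗ f) n ℤ.+ g 0 ℤ.* f (suc n)    ≡⟨ ℤₚ.+-comm ((tail g ⊗ f) n) _ ⟩
    g 0 ℤ.* f (suc n) ℤ.+ (tail g ⊗ f) n    ≡⟨ ⊗-suc g f n ⟨
    (g ⊗ f) (suc n)                         ∎
    where open ≡-Reasoning

⊗-distribʳ : ∀ h f g → (f ⊕ g) ⊗ h ≈ (f ⊗ h) ⊕ (g ⊗ h)
⊗-distribʳ h f g = mk λ n → trans
  (sumTo-cong n (λ i → ℤₚ.*-distribʳ-+ (h (n ℕ.∸ i)) (f i) (g i)))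
  (sumTo-+ n _ _)

scale-⊗ : ∀ c f g n → ((λ i → c ℤ.* f i) ⊗ g) n ≡ c ℤ.* (f ⊗ g) n
scale-⊗ c f g n = trans
  (sumTo-cong n (λ i → ℤₚ.*-assoc c (f i) (g (n ℕ.∸ i))))
  (sumTo-*ˡ n c _)

⊗-assoc : ∀ f g h → (f ⊗ g) ⊗ h ≈ f ⊗ (g ⊗ h)
⊗-assoc f g h = mk (go f g h)
  where
  go : ∀ f g h n → ((f ⊗ g) ⊗ h) n ≡ (f ⊗ (g ⊗ h)) n
  go f g h zero = ℤₚ.*-assoc (f 0) (g 0) (h 0)
  go f g h (suc n) = begin
    ((f ⊗ g) ⊗ h) (suc n)
      ≡⟨ ⊗-suc (f ⊗ g) h n ⟩
    f 0 ℤ.* g 0 ℤ.* h (suc n) ℤ.+ (tail (f ⊗ g) ⊗ h) n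
      ≡⟨ cong (ℤ._+_ (f 0 ℤ.* g 0 ℤ.* h (suc n)))
           (at (⊗-cong {tail (f ⊗ g)} {(λ i → f 0 ℤ.* tail g i) ⊕ (tail f ⊗ g)} {h} (mk (⊗-suc f g)) ≈-refl) n) ⟩
    f 0 ℤ.* g 0 ℤ.* h (suc n) ℤ.+ (((λ i → f 0 ℤ.* tail g i) ⊕ (tail f ⊗ g)) ⊗ h) n
      ≡⟨ cong (ℤ._+_ (f 0 ℤ.* g 0 ℤ.* h (suc n))) (at (⊗-distribʳ h (λ i → f 0 ℤ.* tail g i) (tail f ⊗ g)) n) ⟩
    f 0 ℤ.* g 0 ℤ.* h (suc n) ℤ.+ (((λ i → f 0 ℤ.* tail g i) ⊗ h) n ℤ.+ ((tail f ⊗ g) ⊗ h) n)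
      ≡⟨ cong (ℤ._+_ (f 0 ℤ.* g 0 ℤ.* h (suc n))) (cong₂ ℤ._+_ (scale-⊗ (f 0) (tail g) h n) (go (tail f) g h n)) ⟩
    f 0 ℤ.* g 0 ℤ.* h (suc n) ℤ.+ (f 0 ℤ.* (tail g ⊗ h) n ℤ.+ (tail f ⊗ (g ⊗ h)) n)
      ≡⟨ ZS.solve 5 (λ a b c d e → a ZS.:* b ZS.:* c ZS.:+ (a ZS.:* d ZS.:+ e) ZS.:= a ZS.:* (b ZS.:* c ZS.:+ d) ZS.:+ e)
           refl (f 0) (g 0) (h (suc n)) ((tail g ⊗ h) n) ((tail f ⊗ (g ⊗ h)) n) ⟩
    f 0 ℤ.* (g 0 ℤ.* h (suc n) ℤ.+ (tail g ⊗ h) n) ℤ.+ (tail f ⊗ (g ⊗ h)) n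
      ≡⟨ cong (λ x → f 0 ℤ.* x ℤ.+ (tail f ⊗ (g ⊗ h)) n) (⊗-suc g h n) ⟨
    f 0 ℤ.* (g ⊗ h) (suc n) ℤ.+ (tail f ⊗ (g ⊗ h)) n
      ≡⟨ ⊗-suc f (g ⊗ h) n ⟨
    (f ⊗ (g ⊗ h)) (suc n) ∎
    where open ≡-Reasoning

cst-⊗ : ∀ c f n → (cst c ⊗ f) n ≡ c ℤ.* f n
cst-⊗ c f zero = refl
cst-⊗ c f (suc n) = trans (⊗-suc (cst c) f n)
  (trans (cong (ℤ._+_ (c ℤ.* f (suc n))) (sumTo-zero n (λ i _ → ℤₚ.*-zeroˡ (f (n ℕ.∸ i)))))
         (ℤₚ.+-identityʳ _))

⊝_ : PS → PS
(⊝ f) n = ℤ.- f n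

⊗-identityˡ : ∀ f → cst (+ 1) ⊗ f ≈ f
⊗-identityˡ f = mk λ n → trans (cst-⊗ (+ 1) f n) (ℤₚ.*-identityˡ (f n))

PS-commutativeRing : CommutativeRing _ _
PS-commutativeRing = record
  { Carrier = PS ; _≈_ = _≈_ ; _+_ = _⊕_ ; _*_ = _⊗_ ; -_ = ⊝_ ; 0# = zeroPS ; 1# = cst (+ 1)
  ; isCommutativeRing = record
    { isRing = record
      { +-isAbelianGroup = record
        { isGroup = record
          { isMonoid = record
            { isSemigroup = record
              { isMagma = record
                { isEquivalence = record { refl = ≈-refl ; sym = ≈-sym ; trans = ≈-trans }
                ; ∙-cong = ⊕-cong }
              ; assoc = λ f g h → mk λ n → ℤₚ.+-assoc (f n) (g n) (h n) }
            ; identity = (λ f → mk λ n → ℤₚ.+-identityˡ (f n)) , (λ f → mk λ n → ℤₚ.+-identityʳ (f n)) }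
          ; inverse = (λ f → mk λ n → ℤₚ.+-inverseˡ (f n)) , (λ f → mk λ n → ℤₚ.+-inverseʳ (f n))
          ; ⁻¹-cong = λ p → mk λ n → cong ℤ.-_ (at p n) }
        ; comm = λ f g → mk λ n → ℤₚ.+-comm (f n) (g n) }
      ; *-cong = ⊗-cong
      ; *-assoc = ⊗-assoc
      ; *-identity = ⊗-identityˡ , (λ f → ≈-trans (⊗-comm f (cst (+ 1))) (⊗-identityˡ f))
      ; distrib = (λ h f g → ≈-trans (⊗-comm h (f ⊕ g)) (≈-trans (⊗-distribʳ h f g) (⊕-cong (⊗-comm f h) (⊗-comm g h)))) , ⊗-distribʳ }
    ; *-comm = ⊗-comm } }

PS-almostCommutativeRing : AlmostCommutativeRing _ _
PS-almostCommutativeRing = fromCommutativeRing PS-commutativeRing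

-- With integer coefficients the ring solver can compute with the factor `cst (ℤ.- + 1)` by which 1
-- - qᵏ is written.
cst-homomorphism : CommutativeRing.rawRing ℤₚ.+-*-commutativeRing -Raw-AlmostCommutative⟶ PS-almostCommutativeRing
cst-homomorphism = record
  { ⟦_⟧ = cst
  ; +-homo = λ a b → mk λ { zero → refl ; (suc n) → refl }
  ; *-homo = λ a b → mk λ { zero → refl ; (suc n) → sym (trans (cst-⊗ a (cst b) (suc n)) (ℤₚ.*-zeroʳ a)) }
  ; -‿homo = λ a → mk λ { zero → refl ; (suc n) → refl }
  ; 0-homo = mk λ { zero → refl ; (suc n) → refl }
  ; 1-homo = ≈-refl }

cst-≟ : WeaklyDecidable (Induced-equivalence cst-homomorphism)
cst-≟ a b with a ℤ.≟ b
... | yes refl = just ≈-refl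
... | no _ = nothing

module PSolver = RingSolver (CommutativeRing.rawRing ℤₚ.+-*-commutativeRing) PS-almostCommutativeRing cst-homomorphism cst-≟
module ≈-Reasoning = SetoidReasoning (CommutativeRing.setoid PS-commutativeRing)

⊗-congˡ : ∀ f {g g′} → g ≈ g′ → f ⊗ g ≈ f ⊗ g′
⊗-congˡ f p = ⊗-cong (≈-refl {f}) p

⊗-congʳ : ∀ g {f f′} → f ≈ f′ → f ⊗ g ≈ f′ ⊗ g
⊗-congʳ g p = ⊗-cong p (≈-refl {g})

⊕-congˡ : ∀ f {g g′} → g ≈ g′ → f ⊕ g ≈ f ⊕ g′
⊕-congˡ f p = ⊕-cong (≈-refl {f}) p

⊕-congʳ : ∀ g {f f′} → f ≈ f′ → f ⊕ g ≈ f′ ⊕ g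
⊕-congʳ g p = ⊕-cong p (≈-refl {g})

⊕-identityˡ : ∀ f → zeroPS ⊕ f ≈ f
⊕-identityˡ = CommutativeRing.+-identityˡ PS-commutativeRing

⊕-identityʳ : ∀ f → f ⊕ zeroPS ≈ f
⊕-identityʳ = CommutativeRing.+-identityʳ PS-commutativeRing

cst-0 : cst (+ 0) ≈ zeroPS
cst-0 = mk λ { zero → refl ; (suc n) → refl }

⊗-zeroˡ : ∀ f → zeroPS ⊗ f ≈ zeroPS
⊗-zeroˡ f = CommutativeRing.zeroˡ PS-commutativeRing f

⊗-zeroʳ : ∀ f → f ⊗ zeroPS ≈ zeroPS
⊗-zeroʳ f = CommutativeRing.zeroʳ PS-commutativeRing f

-- Inverses of power series with constant term 1

≤ᵇ-true : ∀ {i n} → i ≤ n → (i ≤ᵇ n) ≡ true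
≤ᵇ-true {i} {n} i≤n with i ≤ᵇ n | ℕₚ.≤⇒≤ᵇ i≤n
... | true | _ = refl

≤ᵇ-false : ∀ {i n} → n < i → (i ≤ᵇ n) ≡ false
≤ᵇ-false {i} {n} n<i with i ≤ᵇ n | ℕₚ.≤ᵇ⇒≤ i n
... | false | _ = refl
... | true  | p = ⊥-elim (ℕₚ.<⇒≱ n<i (p tt))

≡ᵇ-refl : ∀ n → (n ≡ᵇ n) ≡ true
≡ᵇ-refl zero = refl
≡ᵇ-refl (suc n) = ≡ᵇ-refl n

invUpTo-stable : ∀ a n i → i ≤ n → invUpTo a n i ≡ inv a i
invUpTo-stable a zero zero z≤n = refl
invUpTo-stable a (suc n) i i≤1+n with i ℕ.≟ suc n
... | yes refl = refl
... | no i≢ rewrite ≤ᵇ-true (ℕ.s≤s⁻¹ (ℕₚ.≤∧≢⇒< i≤1+n i≢)) =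
  invUpTo-stable a n i (ℕ.s≤s⁻¹ (ℕₚ.≤∧≢⇒< i≤1+n i≢))

-- Stability replaces the truncated table `invUpTo a n` by `inv a`, which makes the defining
-- recursion a convolution.
inv-suc : ∀ a n → inv a (suc n) ≡ ℤ.- (tail a ⊗ inv a) n
inv-suc a n rewrite ≤ᵇ-false (ℕₚ.n<1+n n) | ≡ᵇ-refl n =
  cong ℤ.-_ (sumTo-cong n (λ j → cong (a (suc j) ℤ.*_) (invUpTo-stable a n (n ℕ.∸ j) (ℕₚ.m∸n≤m n j))))

⊗-inverseʳ : ∀ f → f 0 ≡ + 1 → f ⊗ inv f ≈ cst (+ 1)
⊗-inverseʳ f f₀ = mk λ
  { zero → cong (ℤ._* + 1) f₀
  ; (suc n) → trans (⊗-suc f (inv f) n)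
      (trans (cong₂ (λ a b → a ℤ.* b ℤ.+ (tail f ⊗ inv f) n) f₀ (inv-suc f n))
      (trans (cong (ℤ._+ (tail f ⊗ inv f) n) (ℤₚ.*-identityˡ (ℤ.- (tail f ⊗ inv f) n))) (ℤₚ.+-inverseˡ ((tail f ⊗ inv f) n)))) }

divide : ∀ f {g h} → f 0 ≡ + 1 → f ⊗ g ≈ h → g ≈ h ⊗ inv f
divide f {g} {h} f₀ p = begin
  g                 ≈⟨ ⊗-identityˡ g ⟨
  cst (+ 1) ⊗ g     ≈⟨ ⊗-congʳ g (⊗-inverseʳ f f₀) ⟨
  f ⊗ inv f ⊗ g     ≈⟨ solve 3 (λ f i g → f :* i :* g := f :* g :* i) ≈-refl f (inv f) g ⟩
  f ⊗ g ⊗ inv f     ≈⟨ ⊗-congʳ (inv f) p ⟩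
  h ⊗ inv f         ∎
  where open ≈-Reasoning
        open PSolver

inv-unique : ∀ f {g} → f 0 ≡ + 1 → f ⊗ g ≈ cst (+ 1) → g ≈ inv f
inv-unique f f₀ p = ≈-trans (divide f f₀ p) (⊗-identityˡ (inv f))

⊗-cancel-0 : ∀ f {g} → f 0 ≡ + 1 → f ⊗ g ≈ zeroPS → g ≈ zeroPS
⊗-cancel-0 f f₀ p = ≈-trans (divide f f₀ p) (⊗-zeroˡ (inv f))

-- Monomials and q-factorials

oM : PS → PS
oM f = cst (+ 1) ⊕ cst (ℤ.- + 1) ⊗ f

oM-cong : ∀ {f g} → f ≈ g → oM f ≈ oM g
oM-cong p = ⊕-cong (≈-refl {cst (+ 1)}) (⊗-congˡ (cst (ℤ.- + 1)) p)

mono-0 : mono 0 ≈ cst (+ 1)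
mono-0 = mk λ { zero → refl ; (suc n) → refl }

mono-suc-⊗-zero : ∀ e f → (mono (suc e) ⊗ f) 0 ≡ + 0
mono-suc-⊗-zero e f = ℤₚ.*-zeroˡ (f 0)

mono-suc-⊗-suc : ∀ e f n → (mono (suc e) ⊗ f) (suc n) ≡ (mono e ⊗ f) n
mono-suc-⊗-suc e f n = trans (⊗-suc (mono (suc e)) f n)
  (trans (cong (ℤ._+ (mono e ⊗ f) n) (ℤₚ.*-zeroˡ (f (suc n)))) (ℤₚ.+-identityˡ _))

mono-⊗-< : ∀ e f n → n < e → (mono e ⊗ f) n ≡ + 0
mono-⊗-< (suc e) f zero _ = mono-suc-⊗-zero e f
mono-⊗-< (suc e) f (suc n) (s≤s p) = trans (mono-suc-⊗-suc e f n) (mono-⊗-< e f n p)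

mono-⊗-+ : ∀ e f n → (mono e ⊗ f) (e ℕ.+ n) ≡ f n
mono-⊗-+ zero f n = trans (at (⊗-congʳ f mono-0) n) (at (⊗-identityˡ f) n)
mono-⊗-+ (suc e) f n = trans (mono-suc-⊗-suc e f (e ℕ.+ n)) (mono-⊗-+ e f n)

mono-⊗-≥ : ∀ e f n → e ≤ n → (mono e ⊗ f) n ≡ f (n ℕ.∸ e)
mono-⊗-≥ e f n e≤n = trans (cong (mono e ⊗ f) (sym (ℕₚ.m+[n∸m]≡n e≤n))) (mono-⊗-+ e f (n ℕ.∸ e))

mono-+ : ∀ a b → mono (a ℕ.+ b) ≈ mono a ⊗ mono b
mono-+ zero b = ≈-sym (≈-trans (⊗-congʳ (mono b) mono-0) (⊗-identityˡ (mono b)))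
mono-+ (suc a) b = mk λ
  { zero → sym (mono-suc-⊗-zero a (mono b))
  ; (suc n) → trans (at (mono-+ a b) n) (sym (mono-suc-⊗-suc a (mono b) n)) }

mono-cancel : ∀ e {f g} → mono e ⊗ f ≈ mono e ⊗ g → f ≈ g
mono-cancel e {f} {g} p = mk λ n →
  trans (sym (mono-⊗-+ e f n)) (trans (at p (e ℕ.+ n)) (mono-⊗-+ e g n))

oneMinusQ₀ : ∀ k → oneMinusQ (suc k) 0 ≡ + 1
oneMinusQ₀ k = refl

qpoch₀ : ∀ n → qpoch n 0 ≡ + 1
qpoch₀ zero = refl
qpoch₀ (suc n) = cong (ℤ._* + 1) (qpoch₀ n)

^PS₀ : ∀ f k → f 0 ≡ + 1 → (f ^PS k) 0 ≡ + 1
^PS₀ f zero f₀ = refl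
^PS₀ f (suc k) f₀ = cong₂ ℤ._*_ f₀ (^PS₀ f k f₀)

inv-qpoch-step : ∀ n → inv (qpoch (suc n)) ⊗ oneMinusQ (suc n) ≈ inv (qpoch n)
inv-qpoch-step n = inv-unique (qpoch n) (qpoch₀ n) (begin
  qpoch n ⊗ (inv (qpoch (suc n)) ⊗ oneMinusQ (suc n))
    ≈⟨ solve 3 (λ a i b → a :* (i :* b) := (a :* b) :* i) ≈-refl (qpoch n) (inv (qpoch (suc n))) (oneMinusQ (suc n)) ⟩
  qpoch (suc n) ⊗ inv (qpoch (suc n))
    ≈⟨ ⊗-inverseʳ (qpoch (suc n)) (qpoch₀ (suc n)) ⟩
  cst (+ 1) ∎)
  where open ≈-Reasoning
        open PSolver

ΣPS-cong : ∀ N {f g} → (∀ n → suc n ≤ N → f (suc n) ≈ g (suc n)) → ΣPS N f ≈ ΣPS N g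
ΣPS-cong zero h = ≈-refl
ΣPS-cong (suc N) h = ⊕-cong (ΣPS-cong N (λ n n≤N → h n (ℕₚ.m≤n⇒m≤1+n n≤N))) (h N ℕₚ.≤-refl)

ΣPS-⊕ : ∀ N f g → ΣPS N (λ n → f n ⊕ g n) ≈ ΣPS N f ⊕ ΣPS N g
ΣPS-⊕ zero f g = mk λ _ → refl
ΣPS-⊕ (suc N) f g = ≈-trans (⊕-cong (ΣPS-⊕ N f g) ≈-refl)
  (solve 4 (λ a b c d → (a :+ b) :+ (c :+ d) := (a :+ c) :+ (b :+ d)) ≈-refl
    (ΣPS N f) (ΣPS N g) (f (suc N)) (g (suc N)))
  where open PSolver

ΣPS-⊗ˡ : ∀ N c f → ΣPS N (λ n → c ⊗ f n) ≈ c ⊗ ΣPS N f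
ΣPS-⊗ˡ zero c f = ≈-sym (⊗-zeroʳ c)
ΣPS-⊗ˡ (suc N) c f = ≈-trans (⊕-cong (ΣPS-⊗ˡ N c f) ≈-refl)
  (solve 3 (λ c a b → c :* a :+ c :* b := c :* (a :+ b)) ≈-refl c (ΣPS N f) (f (suc N)))
  where open PSolver

-- The partial fraction expansion

-- The number n(n-1)/2, by recursion, so that the exponent grows by n without any halving.
tri : ℕ → ℕ
tri zero = 0
tri (suc n) = tri n ℕ.+ n

D : ℕ → ℕ → PS
D N n = inv (qpoch (N ℕ.+ n)) ⊗ inv (qpoch (N ℕ.∸ n))

-- Both sides reduce to 1/((q)_{N+1+n} (q)_{N-n}). This compares consecutive indices n in the
-- telescoping sum.
D-shift : ∀ N n → n ≤ N →
  D (suc N) n ⊗ oneMinusQ (suc N ℕ.∸ n) ≈ D (suc N) (suc n) ⊗ oneMinusQ (suc N ℕ.+ suc n)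
D-shift N n n≤N rewrite ℕₚ.+-∸-assoc 1 n≤N | ℕₚ.+-suc N n = begin
  a₁ ⊗ b₁ ⊗ oneMinusQ (suc (N ℕ.∸ n))      ≈⟨ ⊗-assoc a₁ b₁ (oneMinusQ (suc (N ℕ.∸ n))) ⟩
  a₁ ⊗ (b₁ ⊗ oneMinusQ (suc (N ℕ.∸ n)))    ≈⟨ ⊗-congˡ a₁ (inv-qpoch-step (N ℕ.∸ n)) ⟩
  a₁ ⊗ b₀                                  ≈⟨ ⊗-congʳ b₀ (inv-qpoch-step (suc N ℕ.+ n)) ⟨
  a₂ ⊗ oneMinusQ (suc (suc N ℕ.+ n)) ⊗ b₀  ≈⟨ solve 3 (λ a o b → a :* o :* b := a :* b :* o) ≈-refl a₂ (oneMinusQ (suc (suc N ℕ.+ n))) b₀ ⟩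
  a₂ ⊗ b₀ ⊗ oneMinusQ (suc (suc N ℕ.+ n))  ∎
  where
  open ≈-Reasoning
  open PSolver
  a₁ = inv (qpoch (suc N ℕ.+ n))
  a₂ = inv (qpoch (suc (suc N ℕ.+ n)))
  b₁ = inv (qpoch (suc (N ℕ.∸ n)))
  b₀ = inv (qpoch (N ℕ.∸ n))

D-step : ∀ N n → n ≤ N →
  D (suc N) n ⊗ oneMinusQ (suc N ℕ.∸ n) ⊗ oneMinusQ (suc N ℕ.+ n) ≈ D N n
D-step N n n≤N rewrite ℕₚ.+-∸-assoc 1 n≤N = begin
  a₁ ⊗ b₁ ⊗ o₁ ⊗ o₂        ≈⟨ solve 4 (λ a b x y → a :* b :* x :* y := (a :* y) :* (b :* x)) ≈-refl a₁ b₁ o₁ o₂ ⟩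
  (a₁ ⊗ o₂) ⊗ (b₁ ⊗ o₁)    ≈⟨ ⊗-cong (inv-qpoch-step (N ℕ.+ n)) (inv-qpoch-step (N ℕ.∸ n)) ⟩
  D N n                    ∎
  where
  open ≈-Reasoning
  open PSolver
  a₁ = inv (qpoch (suc N ℕ.+ n))
  b₁ = inv (qpoch (suc (N ℕ.∸ n)))
  o₁ = oneMinusQ (suc (N ℕ.∸ n))
  o₂ = oneMinusQ (suc N ℕ.+ n)

oneMinusQ-0 : oneMinusQ 0 ≈ zeroPS
oneMinusQ-0 = mk λ { zero → refl ; (suc n) → trans (ℤₚ.+-identityˡ _) (trans (cst-⊗ (ℤ.- + 1) (mono 0) (suc n)) refl) }

w : ℕ → ℕ → PS
w N n = cst (sgn (n ℕ.∸ 1)) ⊗ mono (tri n) ⊗ oneMinusQ n ⊗ D N n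

d : ℕ → ℕ → PS
d N m = ΣPS N (λ n → w N n ⊗ mono (n ℕ.* m))

-- Equal to w N n for n ≤ N, but zero at n = N + 1, where w N n is a junk value (N ∸ n = 0).
w↓ : ℕ → ℕ → PS
w↓ N n = w (suc N) n ⊗ oneMinusQ (suc N ℕ.∸ n) ⊗ oneMinusQ (suc N ℕ.+ n)

w↓-≤ : ∀ N n → n ≤ N → w↓ N n ≈ w N n
w↓-≤ N n n≤N = ≈-trans
  (solve 4 (λ c e x y → c :* e :* x :* y := c :* (e :* x :* y)) ≈-refl
    c (D (suc N) n) (oneMinusQ (suc N ℕ.∸ n)) (oneMinusQ (suc N ℕ.+ n)))
  (⊗-congˡ c (D-step N n n≤N))
  where
  open PSolver
  c = cst (sgn (n ℕ.∸ 1)) ⊗ mono (tri n) ⊗ oneMinusQ n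

w↓-top : ∀ N → w↓ N (suc N) ≈ zeroPS
w↓-top N = ≈-trans
  (⊗-congʳ o (≈-trans (⊗-congˡ W (≈-trans (≈-reflexive (cong oneMinusQ (ℕₚ.n∸n≡0 N))) oneMinusQ-0)) (⊗-zeroʳ W)))
  (⊗-zeroˡ o)
  where
  o = oneMinusQ (suc N ℕ.+ suc N)
  W = w (suc N) (suc N)

Σw↓ : ∀ N m → ΣPS (suc N) (λ n → w↓ N n ⊗ mono (n ℕ.* m)) ≈ d N m
Σw↓ N m = begin
  ΣPS N (λ n → w↓ N n ⊗ mono (n ℕ.* m)) ⊕ w↓ N (suc N) ⊗ mono (suc N ℕ.* m)
    ≈⟨ ⊕-cong (ΣPS-cong N (λ n n≤N → ⊗-congʳ (mono (suc n ℕ.* m)) (w↓-≤ N (suc n) n≤N))) (≈-trans (⊗-congʳ (mono (suc N ℕ.* m)) (w↓-top N)) (⊗-zeroˡ (mono (suc N ℕ.* m)))) ⟩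
  d N m ⊕ zeroPS
    ≈⟨ ⊕-identityʳ (d N m) ⟩
  d N m ∎
  where open ≈-Reasoning

mono-split : ∀ {n N} → n ≤ N → mono N ≈ mono n ⊗ mono (N ℕ.∸ n)
mono-split {n} {N} n≤N = ≈-trans (≈-reflexive (cong mono (sym (ℕₚ.m+[n∸m]≡n n≤N)))) (mono-+ n (N ℕ.∸ n))

mono-*-suc : ∀ n m → mono (n ℕ.* suc m) ≈ mono n ⊗ mono (n ℕ.* m)
mono-*-suc n m = ≈-trans (≈-reflexive (cong mono (ℕₚ.*-suc n m))) (mono-+ n (n ℕ.* m))

mono-N+n : ∀ {n N} → n ≤ N → mono (N ℕ.+ n) ≈ mono n ⊗ mono n ⊗ mono (N ℕ.∸ n)
mono-N+n {n} {N} n≤N = ≈-trans (mono-+ N n) (≈-trans (⊗-congʳ (mono n) (mono-split n≤N))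
  (solve 2 (λ x y → x :* y :* x := x :* x :* y) ≈-refl (mono n) (mono (N ℕ.∸ n))))
  where open PSolver

-- The recurrence is linear, so it may be checked term by term.
ΣPS-rec : ∀ N Q (a b c e : ℕ → PS) →
  (∀ n → suc n ≤ N → a (suc n) ⊕ Q ⊗ Q ⊗ a (suc n) ≈ b (suc n) ⊕ Q ⊗ (c (suc n) ⊕ e (suc n))) →
  ΣPS N a ⊕ Q ⊗ Q ⊗ ΣPS N a ≈ ΣPS N b ⊕ Q ⊗ (ΣPS N c ⊕ ΣPS N e)
ΣPS-rec N Q a b c e h = begin
  ΣPS N a ⊕ Q ⊗ Q ⊗ ΣPS N a                     ≈⟨ ⊕-congˡ (ΣPS N a) (ΣPS-⊗ˡ N (Q ⊗ Q) a) ⟨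
  ΣPS N a ⊕ ΣPS N (λ n → Q ⊗ Q ⊗ a n)           ≈⟨ ΣPS-⊕ N a (λ n → Q ⊗ Q ⊗ a n) ⟨
  ΣPS N (λ n → a n ⊕ Q ⊗ Q ⊗ a n)               ≈⟨ ΣPS-cong N h ⟩
  ΣPS N (λ n → b n ⊕ Q ⊗ (c n ⊕ e n))           ≈⟨ ΣPS-⊕ N b (λ n → Q ⊗ (c n ⊕ e n)) ⟩
  ΣPS N b ⊕ ΣPS N (λ n → Q ⊗ (c n ⊕ e n))       ≈⟨ ⊕-congˡ (ΣPS N b) (ΣPS-⊗ˡ N Q (λ n → c n ⊕ e n)) ⟩
  ΣPS N b ⊕ Q ⊗ ΣPS N (λ n → c n ⊕ e n)         ≈⟨ ⊕-congˡ (ΣPS N b) (⊗-congˡ Q (ΣPS-⊕ N c e)) ⟩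
  ΣPS N b ⊕ Q ⊗ (ΣPS N c ⊕ ΣPS N e)             ∎
  where open ≈-Reasoning

d-rec-suc : ∀ N m →
  let Q = mono (suc N) in
  d (suc N) (suc m) ⊕ Q ⊗ Q ⊗ d (suc N) (suc m)
    ≈ d N (suc m) ⊕ Q ⊗ (d (suc N) m ⊕ d (suc N) (suc (suc m)))
d-rec-suc N m = ≈-trans
  (ΣPS-rec (suc N) Q (t (suc m)) (λ n → w↓ N n ⊗ mono (n ℕ.* suc m)) (t m) (t (suc (suc m)))
    (λ n n≤N → term (suc n) n≤N))
  (⊕-cong (Σw↓ N (suc m)) ≈-refl)
  where
  Q = mono (suc N)
  t : ℕ → ℕ → PS
  t m n = w (suc N) n ⊗ mono (n ℕ.* m)
  term : ∀ n → n ≤ suc N → t (suc m) n ⊕ Q ⊗ Q ⊗ t (suc m) n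
    ≈ w↓ N n ⊗ mono (n ℕ.* suc m) ⊕ Q ⊗ (t m n ⊕ t (suc (suc m)) n)
  term n n≤N = begin
    W ⊗ mono (n ℕ.* suc m) ⊕ Q ⊗ Q ⊗ (W ⊗ mono (n ℕ.* suc m))
      ≈⟨ ⊕-cong (⊗-congˡ W eM) (⊗-cong (⊗-cong eQ eQ) (⊗-congˡ W eM)) ⟩
    W ⊗ (x ⊗ M) ⊕ (x ⊗ y) ⊗ (x ⊗ y) ⊗ (W ⊗ (x ⊗ M))
      -- With x = qⁿ and y = q^{N+1-n}, Q = xy and q^{N+1+n} = x²y, so no negative power is left:
      -- x(1 + Q²) = (1 - y)(1 - x²y)x + xy(1 + x²).
      ≈⟨ solve 4 (λ W x y M → W :* (x :* M) :+ (x :* y) :* (x :* y) :* (W :* (x :* M))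
           := W :* (con (+ 1) :+ con (ℤ.- + 1) :* y) :* (con (+ 1) :+ con (ℤ.- + 1) :* (x :* x :* y)) :* (x :* M)
              :+ (x :* y) :* (W :* M :+ W :* (x :* (x :* M)))) ≈-refl W x y M ⟩
    W ⊗ oM y ⊗ oM (x ⊗ x ⊗ y) ⊗ (x ⊗ M) ⊕ (x ⊗ y) ⊗ (W ⊗ M ⊕ W ⊗ (x ⊗ (x ⊗ M)))
      ≈⟨ ⊕-cong (⊗-cong (⊗-congˡ (W ⊗ oM y) (oM-cong (mono-N+n n≤N))) eM)
           (⊗-cong eQ (⊕-congˡ (W ⊗ M) (⊗-congˡ W (≈-trans (mono-*-suc n (suc m)) (⊗-congˡ x eM))))) ⟨
    w↓ N n ⊗ mono (n ℕ.* suc m) ⊕ Q ⊗ (t m n ⊕ t (suc (suc m)) n) ∎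
    where
    open ≈-Reasoning
    open PSolver
    W = w (suc N) n
    x = mono n
    y = mono (suc N ℕ.∸ n)
    M = mono (n ℕ.* m)
    eM = mono-*-suc n m
    eQ = mono-split n≤N

-- The defect of the recurrence at m = 0, where the neighbours |m - 1| and |m + 1| are both 1:
-- with y = q^{N+1-n}, (1 + Q² - 2Qqⁿ) - (1 - y)(1 - yq²ⁿ) = y(1 - q²ⁿ).
resid : ℕ → ℕ → PS
resid N n = w (suc N) n ⊗ mono (suc N ℕ.∸ n) ⊗ oM (mono n ⊗ mono n)

d-rec-zero : ∀ N →
  let Q = mono (suc N) in
  d (suc N) 0 ⊕ Q ⊗ Q ⊗ d (suc N) 0
    ≈ (d N 0 ⊕ ΣPS (suc N) (resid N)) ⊕ Q ⊗ (d (suc N) 1 ⊕ d (suc N) 1)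
d-rec-zero N = ≈-trans
  (ΣPS-rec (suc N) Q (t 0) (λ n → w↓ N n ⊗ mono (n ℕ.* 0) ⊕ resid N n) (t 1) (t 1)
    (λ n n≤N → term (suc n) n≤N))
  (⊕-cong (≈-trans (ΣPS-⊕ (suc N) (λ n → w↓ N n ⊗ mono (n ℕ.* 0)) (resid N)) (⊕-cong (Σw↓ N 0) ≈-refl)) ≈-refl)
  where
  Q = mono (suc N)
  t : ℕ → ℕ → PS
  t m n = w (suc N) n ⊗ mono (n ℕ.* m)
  term : ∀ n → n ≤ suc N → t 0 n ⊕ Q ⊗ Q ⊗ t 0 n
    ≈ (w↓ N n ⊗ mono (n ℕ.* 0) ⊕ resid N n) ⊕ Q ⊗ (t 1 n ⊕ t 1 n)
  term n n≤N = begin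
    W ⊗ M ⊕ Q ⊗ Q ⊗ (W ⊗ M)
      ≈⟨ ⊕-cong (⊗-congˡ W e1) (⊗-cong (⊗-cong eQ eQ) (⊗-congˡ W e1)) ⟩
    W ⊗ cst (+ 1) ⊕ (x ⊗ y) ⊗ (x ⊗ y) ⊗ (W ⊗ cst (+ 1))
      ≈⟨ solve 3 (λ W x y → W :* con (+ 1) :+ (x :* y) :* (x :* y) :* (W :* con (+ 1))
           := (W :* (con (+ 1) :+ con (ℤ.- + 1) :* y) :* (con (+ 1) :+ con (ℤ.- + 1) :* (x :* x :* y)) :* con (+ 1)
                 :+ W :* y :* (con (+ 1) :+ con (ℤ.- + 1) :* (x :* x)))
              :+ (x :* y) :* (W :* (x :* con (+ 1)) :+ W :* (x :* con (+ 1)))) ≈-refl W x y ⟩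
    (W ⊗ oM y ⊗ oM (x ⊗ x ⊗ y) ⊗ cst (+ 1) ⊕ resid N n) ⊕ (x ⊗ y) ⊗ (W ⊗ (x ⊗ cst (+ 1)) ⊕ W ⊗ (x ⊗ cst (+ 1)))
      ≈⟨ ⊕-cong (⊕-cong (⊗-cong (⊗-congˡ (W ⊗ oM y) (oM-cong (mono-N+n n≤N))) e1) ≈-refl)
           (⊗-cong eQ (⊕-cong (⊗-congˡ W e2) (⊗-congˡ W e2))) ⟨
    (w↓ N n ⊗ M ⊕ resid N n) ⊕ Q ⊗ (t 1 n ⊕ t 1 n) ∎
    where
    open ≈-Reasoning
    open PSolver
    W = w (suc N) n
    x = mono n
    y = mono (suc N ℕ.∸ n)
    M = mono (n ℕ.* 0)
    e1 : M ≈ cst (+ 1)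
    e1 = ≈-trans (≈-reflexive (cong mono (ℕₚ.*-zeroʳ n))) mono-0
    e2 = ≈-trans (mono-*-suc n 0) (⊗-congˡ x e1)
    eQ = mono-split n≤N

-- The antidifference of the residual terms, found by the q-Gosper algorithm.
G : ℕ → ℕ → PS
G N k = cst (ℤ.- sgn k) ⊗ mono (tri k) ⊗ oneMinusQ k ⊗ oneMinusQ (suc k) ⊗ (D (suc N) k ⊗ oneMinusQ (suc N ℕ.∸ k))

-- The true antidifference is q^N `G` / (1 - q^N); its denominator is cleared here. At N = 0 the
-- left factor is 0 and nothing is learnt about the sum, so that case is computed directly in
-- `Σresid-zero`.
resid-telescope : ∀ N k → k ≤ suc N →
  oneMinusQ N ⊗ ΣPS k (resid N) ≈ mono N ⊗ G N k
resid-telescope N zero _ = begin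
  oneMinusQ N ⊗ zeroPS  ≈⟨ ⊗-zeroʳ (oneMinusQ N) ⟩
  zeroPS                ≈⟨ cst-0 ⟨
  cst (+ 0)             ≈⟨ solve 4 (λ m c u v → con (+ 0) := m :* (c :* con (+ 0) :* u :* v)) ≈-refl (mono N) c u v ⟩
  mono N ⊗ (c ⊗ cst (+ 0) ⊗ u ⊗ v)  ≈⟨ ⊗-congˡ (mono N) (⊗-congʳ v (⊗-congʳ u (⊗-congˡ c (≈-trans oneMinusQ-0 (≈-sym cst-0))))) ⟨
  mono N ⊗ G N 0        ∎
  where
  open ≈-Reasoning
  open PSolver
  c = cst (ℤ.- sgn 0) ⊗ mono (tri 0)
  u = oneMinusQ 1
  v = D (suc N) 0 ⊗ oneMinusQ (suc N)
resid-telescope N (suc k) (s≤s k≤N) = begin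
  oneMinusQ N ⊗ (ΣPS k (resid N) ⊕ resid N (suc k))
    ≈⟨ solve 3 (λ o a b → o :* (a :+ b) := o :* a :+ o :* b) ≈-refl (oneMinusQ N) (ΣPS k (resid N)) (resid N (suc k)) ⟩
  oneMinusQ N ⊗ ΣPS k (resid N) ⊕ oneMinusQ N ⊗ resid N (suc k)
    ≈⟨ ⊕-cong (≈-trans (resid-telescope N k (ℕₚ.m≤n⇒m≤1+n k≤N)) (⊗-cong eN eG)) (⊗-cong (oM-cong eN) eR) ⟩
  (x ⊗ y) ⊗ (cst (ℤ.- + 1) ⊗ s ⊗ τ ⊗ oM x ⊗ oM (q ⊗ x) ⊗ (E ⊗ oM (q ⊗ q ⊗ x ⊗ x ⊗ y)))
    ⊕ oM (x ⊗ y) ⊗ ((s ⊗ (τ ⊗ x) ⊗ oM (q ⊗ x) ⊗ E) ⊗ y ⊗ oM ((q ⊗ x) ⊗ (q ⊗ x)))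
    -- Without the common factor xysτE(1 - qx) this reads (1 - xy)(1 - q²x²) - (1 - x)(1 - q²x²y) =
    -- x(1 - y)(1 - q²x).
    ≈⟨ solve 6 (λ s τ E x y q →
         let o = λ f → con (+ 1) :+ con (ℤ.- + 1) :* f in
         (x :* y) :* (con (ℤ.- + 1) :* s :* τ :* o x :* o (q :* x) :* (E :* o (q :* q :* x :* x :* y)))
           :+ o (x :* y) :* ((s :* (τ :* x) :* o (q :* x) :* E) :* y :* o ((q :* x) :* (q :* x)))
         := (x :* y) :* (s :* (τ :* x) :* o (q :* x) :* o (q :* (q :* x)) :* (E :* o y)))
         ≈-refl s τ E x y q ⟩
  (x ⊗ y) ⊗ (s ⊗ (τ ⊗ x) ⊗ oM (q ⊗ x) ⊗ oM (q ⊗ (q ⊗ x)) ⊗ (E ⊗ oM y))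
    ≈⟨ ⊗-cong eN eG′ ⟨
  mono N ⊗ G N (suc k) ∎
  where
  open ≈-Reasoning
  open PSolver
  q = mono 1
  x = mono k
  y = mono (N ℕ.∸ k)
  s = cst (sgn k)
  τ = mono (tri k)
  E = D (suc N) (suc k)
  eN : mono N ≈ x ⊗ y
  eN = mono-split k≤N
  eq : mono (suc k) ≈ q ⊗ x
  eq = mono-+ 1 k
  eqq : mono (suc N ℕ.+ suc k) ≈ q ⊗ q ⊗ x ⊗ x ⊗ y
  eqq = ≈-trans (mono-+ (suc N) (suc k)) (≈-trans (⊗-cong (≈-trans (mono-+ 1 N) (⊗-congˡ q eN)) eq)
    (solve 3 (λ q x y → (q :* (x :* y)) :* (q :* x) := q :* q :* x :* x :* y) ≈-refl q x y))
  eτ : mono (tri (suc k)) ≈ τ ⊗ x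
  eτ = mono-+ (tri k) k
  es : cst (ℤ.- sgn k) ≈ cst (ℤ.- + 1) ⊗ s
  es = mk λ n → trans (neg n) (sym (trans (cst-⊗ (ℤ.- + 1) s n) (ℤₚ.-1*i≡-i (s n))))
    where
    neg : ∀ n → cst (ℤ.- sgn k) n ≡ ℤ.- cst (sgn k) n
    neg zero = refl
    neg (suc n) = refl
  eG : G N k ≈ cst (ℤ.- + 1) ⊗ s ⊗ τ ⊗ oM x ⊗ oM (q ⊗ x) ⊗ (E ⊗ oM (q ⊗ q ⊗ x ⊗ x ⊗ y))
  eG = ⊗-cong (⊗-cong (⊗-congʳ (oM x) (⊗-congʳ τ es)) (oM-cong eq))
    (≈-trans (D-shift N k k≤N) (⊗-congˡ E (oM-cong eqq)))
  eR : resid N (suc k) ≈ (s ⊗ (τ ⊗ x) ⊗ oM (q ⊗ x) ⊗ E) ⊗ y ⊗ oM ((q ⊗ x) ⊗ (q ⊗ x))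
  eR = ⊗-cong (⊗-congʳ y (⊗-congʳ E (⊗-cong (⊗-congˡ s eτ) (oM-cong eq)))) (oM-cong (⊗-cong eq eq))
  eG′ : G N (suc k) ≈ s ⊗ (τ ⊗ x) ⊗ oM (q ⊗ x) ⊗ oM (q ⊗ (q ⊗ x)) ⊗ (E ⊗ oM y)
  eG′ = ⊗-congʳ (E ⊗ oM y) (⊗-cong (⊗-cong (⊗-cong (≈-reflexive (cong cst (ℤₚ.neg-involutive (sgn k)))) eτ) (oM-cong eq))
    (oM-cong (≈-trans (mono-+ 1 (suc k)) (⊗-congˡ q eq))))

-- At the upper end `G` contains the factor 1 - q⁰ = 0, and 1 - q^{N+1} can be cancelled.
Σresid-suc : ∀ N → ΣPS (suc (suc N)) (resid (suc N)) ≈ zeroPS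
Σresid-suc N = ⊗-cancel-0 (oneMinusQ (suc N)) (oneMinusQ₀ N) (begin
  oneMinusQ (suc N) ⊗ ΣPS (suc (suc N)) (resid (suc N))
    ≈⟨ resid-telescope (suc N) (suc (suc N)) ℕₚ.≤-refl ⟩
  mono (suc N) ⊗ (c ⊗ (E ⊗ oneMinusQ (N ℕ.∸ N)))
    ≈⟨ ⊗-congˡ (mono (suc N)) (⊗-congˡ c (⊗-congˡ E (≈-trans (≈-reflexive (cong oneMinusQ (ℕₚ.n∸n≡0 N))) oneMinusQ-0))) ⟩
  mono (suc N) ⊗ (c ⊗ (E ⊗ zeroPS))
    ≈⟨ ⊗-congˡ (mono (suc N)) (⊗-congˡ c (⊗-zeroʳ E)) ⟩
  mono (suc N) ⊗ (c ⊗ zeroPS)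
    ≈⟨ ⊗-congˡ (mono (suc N)) (⊗-zeroʳ c) ⟩
  mono (suc N) ⊗ zeroPS
    ≈⟨ ⊗-zeroʳ (mono (suc N)) ⟩
  zeroPS ∎)
  where
  open ≈-Reasoning
  E = D (suc (suc N)) (suc (suc N))
  c = cst (ℤ.- sgn (suc (suc N))) ⊗ mono (tri (suc (suc N))) ⊗ oneMinusQ (suc (suc N)) ⊗ oneMinusQ (suc (suc (suc N)))

-- The exceptional defect: it equals K_0(0), which the empty sum `d 0 0` does not provide.
Σresid-zero : ΣPS 1 (resid 0) ≈ cst (+ 1)
Σresid-zero = begin
  zeroPS ⊕ resid 0 1
    ≈⟨ ⊕-identityˡ (resid 0 1) ⟩
  cst (+ 1) ⊗ mono 0 ⊗ oneMinusQ 1 ⊗ (inv (qpoch 2) ⊗ inv (qpoch 0)) ⊗ mono 0 ⊗ oM (mono 1 ⊗ mono 1)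
    ≈⟨ ⊗-cong (⊗-cong (⊗-cong (⊗-congʳ (oneMinusQ 1) (⊗-congˡ (cst (+ 1)) mono-0)) (⊗-congˡ (inv (qpoch 2)) i₀)) mono-0)
         (oM-cong (≈-sym (mono-+ 1 1))) ⟩
  cst (+ 1) ⊗ cst (+ 1) ⊗ oneMinusQ 1 ⊗ (inv (qpoch 2) ⊗ cst (+ 1)) ⊗ cst (+ 1) ⊗ oneMinusQ 2
    ≈⟨ solve 3 (λ a b i → con (+ 1) :* con (+ 1) :* a :* (i :* con (+ 1)) :* con (+ 1) :* b := con (+ 1) :* a :* b :* i)
         ≈-refl (oneMinusQ 1) (oneMinusQ 2) (inv (qpoch 2)) ⟩
  qpoch 2 ⊗ inv (qpoch 2)
    ≈⟨ ⊗-inverseʳ (qpoch 2) (qpoch₀ 2) ⟩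
  cst (+ 1) ∎
  where
  open ≈-Reasoning
  open PSolver
  i₀ : inv (qpoch 0) ≈ cst (+ 1)
  i₀ = ≈-sym (inv-unique (qpoch 0) refl (⊗-identityˡ (cst (+ 1))))

-- Enumeration of partitions by crank

-- Multiplication by (1 - zqᵏ)(1 - qᵏ/z) turns Σ X(m) zᵐ into Σ R(m) zᵐ; the terms are arranged to
-- avoid subtraction.
Rec : ℕ → (ℤ → PS) → (ℤ → PS) → Set
Rec k X R = ∀ m → X m ⊕ mono k ⊗ mono k ⊗ X m ≈ R m ⊕ mono k ⊗ (X (ℤ.pred m) ⊕ X (ℤ.suc m))

-- A positive power of q moves every coefficient up: agreement below n becomes agreement up to n.
mono-⊗-contracts : ∀ e {f g} n → (∀ k → k < n → f k ≡ g k) →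
  ∀ k → k ≤ n → (mono (suc e) ⊗ f) k ≡ (mono (suc e) ⊗ g) k
mono-⊗-contracts e {f} {g} n h k k≤n with suc e ℕ.≤? k
... | no e≰k = trans (mono-⊗-< (suc e) f k (ℕₚ.≰⇒> e≰k)) (sym (mono-⊗-< (suc e) g k (ℕₚ.≰⇒> e≰k)))
... | yes e≤k = trans (mono-⊗-≥ (suc e) f k e≤k) (trans (h (k ℕ.∸ suc e) lt) (sym (mono-⊗-≥ (suc e) g k e≤k)))
  where
  lt : k ℕ.∸ suc e < n
  lt = ℕₚ.<-≤-trans (ℕₚ.∸-monoʳ-< {k} {suc e} {0} (s≤s z≤n) e≤k) k≤n

-- Induction on the exponent of q, for all m at once, because the recurrence at m refers to both m -
-- 1 and m + 1.
Rec-unique : ∀ e X Y R → Rec (suc e) X R → Rec (suc e) Y R → ∀ m → X m ≈ Y m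
Rec-unique e X Y R rX rY m = mk λ k → below (suc k) m k ℕₚ.≤-refl
  where
  Q = mono (suc e)
  isolate : ∀ {Z} → Rec (suc e) Z R → ∀ m k →
    Z m k ≡ R m k ℤ.+ (Q ⊗ (Z (ℤ.pred m) ⊕ Z (ℤ.suc m))) k ℤ.- (Q ⊗ (Q ⊗ Z m)) k
  isolate {Z} rZ m k = begin
    Z m k                                              ≡⟨ ZS.solve 2 (λ a b → a ZS.:= a ZS.:+ b ZS.:- b) refl (Z m k) b ⟩
    Z m k ℤ.+ b ℤ.- b                                  ≡⟨ cong (λ t → Z m k ℤ.+ t ℤ.- b) (at (⊗-assoc Q Q (Z m)) k) ⟨
    Z m k ℤ.+ (Q ⊗ Q ⊗ Z m) k ℤ.- b                    ≡⟨ cong (ℤ._- b) (at (rZ m) k) ⟩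
    R m k ℤ.+ (Q ⊗ (Z (ℤ.pred m) ⊕ Z (ℤ.suc m))) k ℤ.- b ∎
    where
    open ≡-Reasoning
    b = (Q ⊗ (Q ⊗ Z m)) k
  below : ∀ n m k → k < n → X m k ≡ Y m k
  below (suc n) m k (s≤s k≤n) = trans (isolate {X} rX m k) (trans
    (cong₂ (λ a b → R m k ℤ.+ a ℤ.- b)
      (mono-⊗-contracts e n (λ j j<n → cong₂ ℤ._+_ (below n (ℤ.pred m) j j<n) (below n (ℤ.suc m) j j<n)) k k≤n)
      (mono-⊗-contracts e n (λ j j<n → mono-⊗-contracts e n (below n m) j (ℕₚ.<⇒≤ j<n)) k k≤n))
    (sym (isolate {Y} rY m k)))

-- Sums over lists

private variable A B : Set

∑ : (A → ℤ) → List A → ℤ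
∑ f xs = sumℤ (map f xs)

∑-cong : ∀ {f g : A → ℤ} → (∀ x → f x ≡ g x) → ∀ xs → ∑ f xs ≡ ∑ g xs
∑-cong h xs = cong sumℤ (map-cong h xs)

∑-map : ∀ (f : B → ℤ) (g : A → B) xs → ∑ f (map g xs) ≡ ∑ (f ∘ g) xs
∑-map f g xs = cong sumℤ (sym (map-∘ xs))

∑-++ : ∀ (f : A → ℤ) xs ys → ∑ f (xs ++ ys) ≡ ∑ f xs ℤ.+ ∑ f ys
∑-++ f [] ys = sym (ℤₚ.+-identityˡ (∑ f ys))
∑-++ f (x ∷ xs) ys = trans (cong (ℤ._+_ (f x)) (∑-++ f xs ys)) (sym (ℤₚ.+-assoc (f x) (∑ f xs) (∑ f ys)))

∑-concatMap : ∀ (f : B → ℤ) (g : A → List B) xs → ∑ f (concatMap g xs) ≡ ∑ (λ x → ∑ f (g x)) xs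
∑-concatMap f g [] = refl
∑-concatMap f g (x ∷ xs) = trans (∑-++ f (g x) (concatMap g xs)) (cong (ℤ._+_ (∑ f (g x))) (∑-concatMap f g xs))

∑-*ˡ : ∀ c (f : A → ℤ) xs → ∑ (λ x → c ℤ.* f x) xs ≡ c ℤ.* ∑ f xs
∑-*ˡ c f [] = sym (ℤₚ.*-zeroʳ c)
∑-*ˡ c f (x ∷ xs) = trans (cong (ℤ._+_ (c ℤ.* f x)) (∑-*ˡ c f xs)) (sym (ℤₚ.*-distribˡ-+ c (f x) (∑ f xs)))

∑-*ʳ : ∀ c (f : A → ℤ) xs → ∑ (λ x → f x ℤ.* c) xs ≡ ∑ f xs ℤ.* c
∑-*ʳ c f xs = trans (∑-cong (λ x → ℤₚ.*-comm (f x) c) xs) (trans (∑-*ˡ c f xs) (ℤₚ.*-comm c (∑ f xs)))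

∑-zero : ∀ (xs : List A) → ∑ (λ _ → + 0) xs ≡ + 0
∑-zero [] = refl
∑-zero (x ∷ xs) = trans (ℤₚ.+-identityˡ (∑ (λ _ → + 0) xs)) (∑-zero xs)

∑-+ : ∀ (f g : A → ℤ) xs → ∑ (λ x → f x ℤ.+ g x) xs ≡ ∑ f xs ℤ.+ ∑ g xs
∑-+ f g [] = refl
∑-+ f g (x ∷ xs) = trans (cong (ℤ._+_ (f x ℤ.+ g x)) (∑-+ f g xs))
  (ZS.solve 4 (λ a b c d → a ZS.:+ b ZS.:+ (c ZS.:+ d) ZS.:= a ZS.:+ c ZS.:+ (b ZS.:+ d)) refl (f x) (g x) (∑ f xs) (∑ g xs))

∑-swap : ∀ (f : A → B → ℤ) xs ys → ∑ (λ x → ∑ (f x) ys) xs ≡ ∑ (λ y → ∑ (λ x → f x y) xs) ys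
∑-swap f [] ys = sym (∑-zero ys)
∑-swap f (x ∷ xs) ys = trans (cong (ℤ._+_ (∑ (f x) ys)) (∑-swap f xs ys)) (sym (∑-+ (f x) (λ y → ∑ (λ x → f x y) xs) ys))

∑-applyUpTo : ∀ n (f : A → ℤ) (g : ℕ → A) → ∑ f (applyUpTo g (suc n)) ≡ sumTo n (f ∘ g)
∑-applyUpTo zero f g = ℤₚ.+-identityʳ _
∑-applyUpTo (suc n) f g = trans (cong (ℤ._+_ (f (g 0))) (∑-applyUpTo n f (g ∘ suc))) (sym (sumTo-head n (f ∘ g)))

-- Partitions into parts ≤ k, each counted with weight b (number of parts).
u : ℕ → (ℕ → ℤ) → PS
u k b n = ∑ (b ∘ length) (partsLE k n)

u-cong : ∀ k {b b′} → (∀ a → b a ≡ b′ a) → ∀ n → u k b n ≡ u k b′ n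
u-cong k h n = ∑-cong (h ∘ length) (partsLE k n)

-- The contribution of the partitions in which the part k + 1 occurs exactly c times.
u-summand : ℕ → (ℕ → ℤ) → ℕ → ℕ → ℤ
u-summand k b n c = if c ℕ.* suc k ≤ᵇ n then u k (λ a → b (c ℕ.+ a)) (n ℕ.∸ c ℕ.* suc k) else + 0

u-summand-< : ∀ k b {n} c → n < c ℕ.* suc k → u-summand k b n c ≡ + 0
u-summand-< k b c lt rewrite ≤ᵇ-false lt = refl

u-suc : ∀ k b n → u (suc k) b n ≡ sumTo n (u-summand k b n)
u-suc k b n = begin
  u (suc k) b n                                    ≡⟨ ∑-concatMap (b ∘ length) L (upTo (suc n)) ⟩
  ∑ (λ c → ∑ (b ∘ length) (L c)) (upTo (suc n))    ≡⟨ ∑-applyUpTo n (λ c → ∑ (b ∘ length) (L c)) id ⟩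
  sumTo n (λ c → ∑ (b ∘ length) (L c))             ≡⟨ sumTo-cong n step ⟩
  sumTo n (u-summand k b n)                        ∎
  where
  open ≡-Reasoning
  L : ℕ → List (List ℕ)
  L c = if (c ℕ.* suc k) ≤ᵇ n then map (replicate c (suc k) ++_) (partsLE k (n ℕ.∸ (c ℕ.* suc k))) else []
  step : ∀ c → ∑ (b ∘ length) (L c) ≡ u-summand k b n c
  step c with (c ℕ.* suc k) ≤ᵇ n
  ... | false = refl
  ... | true = trans (∑-map (b ∘ length) (replicate c (suc k) ++_) (partsLE k (n ℕ.∸ (c ℕ.* suc k))))
    (∑-cong (λ π → cong b (trans (length-++ (replicate c (suc k))) (cong (ℕ._+ length π) (length-replicate c))))
      (partsLE k (n ℕ.∸ (c ℕ.* suc k))))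

u-summand-suc : ∀ k b r c → u-summand k b (suc k ℕ.+ r) (suc c) ≡ u-summand k (b ∘ suc) r c
u-summand-suc k b r c with c ℕ.* suc k ℕ.≤? r
... | yes p rewrite ≤ᵇ-true p | ≤ᵇ-true (ℕₚ.+-monoʳ-≤ (suc k) p) =
  cong (u k (λ a → b (suc c ℕ.+ a))) (ℕₚ.[m+n]∸[m+o]≡n∸o (suc k) r (c ℕ.* suc k))
... | no p rewrite ≤ᵇ-false (ℕₚ.≰⇒> p) | ≤ᵇ-false (ℕₚ.+-monoʳ-< (suc k) (ℕₚ.≰⇒> p)) = refl

-- Either the part k + 1 is absent, or one copy of it can be removed; `b ∘ suc` remembers the
-- removed part. In terms of multiplicities, c + 1 copies at size n correspond to c copies at size n
-- - (k + 1).
u-rec : ∀ k b → u (suc k) b ≈ u k b ⊕ mono (suc k) ⊗ u (suc k) (b ∘ suc)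
u-rec k b = mk go
  where
  open ≡-Reasoning
  rest : ∀ n → sumTo n (λ c → u-summand k b (suc n) (suc c)) ≡ (mono (suc k) ⊗ u (suc k) (b ∘ suc)) (suc n)
  rest n with k ℕ.≤? n
  ... | no k≰n = trans
    (sumTo-zero n (λ c _ → u-summand-< k b (suc c) (ℕₚ.<-≤-trans (s≤s (ℕₚ.≰⇒> k≰n)) (ℕₚ.m≤m+n (suc k) (c ℕ.* suc k)))))
    (sym (mono-⊗-< (suc k) (u (suc k) (b ∘ suc)) (suc n) (s≤s (ℕₚ.≰⇒> k≰n))))
  ... | yes k≤n with ℕₚ.m≤n⇒∃[o]m+o≡n k≤n
  ... | r , refl = begin
    sumTo (k ℕ.+ r) (λ c → u-summand k b (suc k ℕ.+ r) (suc c))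
      ≡⟨ sumTo-cong (k ℕ.+ r) (u-summand-suc k b r) ⟩
    sumTo (k ℕ.+ r) (u-summand k (b ∘ suc) r)
      -- Multiplicities c > r contribute nothing, since c(k + 1) > r.
      ≡⟨ sumTo-extend (u-summand k (b ∘ suc) r) (ℕₚ.m≤n+m r k)
           (λ c r<c → u-summand-< k (b ∘ suc) c (ℕₚ.<-≤-trans r<c (ℕₚ.m≤m*n c (suc k)))) ⟩
    sumTo r (u-summand k (b ∘ suc) r)
      ≡⟨ u-suc k (b ∘ suc) r ⟨
    u (suc k) (b ∘ suc) r
      ≡⟨ mono-⊗-+ (suc k) (u (suc k) (b ∘ suc)) r ⟨
    (mono (suc k) ⊗ u (suc k) (b ∘ suc)) (suc k ℕ.+ r) ∎
  go : ∀ n → u (suc k) b n ≡ u k b n ℤ.+ (mono (suc k) ⊗ u (suc k) (b ∘ suc)) n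
  go zero = trans (u-suc k b 0) (sym (trans (cong (ℤ._+_ (u k b 0)) (mono-suc-⊗-zero k (u (suc k) (b ∘ suc)))) (ℤₚ.+-identityʳ (u k b 0))))
  go (suc n) = trans (u-suc k b (suc n)) (trans (sumTo-head n (u-summand k b (suc n))) (cong (ℤ._+_ (u k b (suc n))) (rest n)))

-- A convolution whose entries need not be products: the crank condition couples the two partitions.
diag : (ℕ → ℕ → ℤ) → PS
diag F n = sumTo n (λ i → F i (n ℕ.∸ i))

diag-cong : ∀ {F G : ℕ → ℕ → ℤ} → (∀ i j → F i j ≡ G i j) → diag F ≈ diag G
diag-cong h = mk λ n → sumTo-cong n (λ i → h i (n ℕ.∸ i))

diag-flip : ∀ F → diag F ≈ diag (flip F)
diag-flip F = mk (go F)
  where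
  go : ∀ F n → diag F n ≡ diag (flip F) n
  go F zero = refl
  go F (suc n) = begin
    diag F (suc n)                                        ≡⟨ sumTo-head n (λ i → F i (suc n ℕ.∸ i)) ⟩
    F 0 (suc n) ℤ.+ diag (F ∘ suc) n                      ≡⟨ ℤₚ.+-comm (F 0 (suc n)) (diag (F ∘ suc) n) ⟩
    diag (F ∘ suc) n ℤ.+ F 0 (suc n)                      ≡⟨ cong (ℤ._+ F 0 (suc n)) (go (F ∘ suc) n) ⟩
    diag (flip (F ∘ suc)) n ℤ.+ F 0 (suc n)
      ≡⟨ cong₂ ℤ._+_ (sumTo-cong≤ n (λ i i≤n → cong (λ k → F k i) (ℕₚ.+-∸-assoc 1 i≤n)))
                     (cong (λ k → F k (suc n)) (ℕₚ.n∸n≡0 n)) ⟨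
    diag (flip F) (suc n)                                 ∎
    where open ≡-Reasoning

diag-shift : ∀ e F → diag (λ i j → (mono e ⊗ flip F j) i) ≈ mono e ⊗ diag F
diag-shift zero F = ≈-trans
  (diag-cong (λ i j → mono-⊗-+ 0 (flip F j) i))
  (mk λ n → sym (mono-⊗-+ 0 (diag F) n))
diag-shift (suc e) F = mk λ
  { zero → trans (mono-suc-⊗-zero e (flip F 0)) (sym (mono-suc-⊗-zero e (diag F)))
  ; (suc n) → begin
      diag (λ i j → (mono (suc e) ⊗ flip F j) i) (suc n)
        ≡⟨ sumTo-head n (λ i → (mono (suc e) ⊗ flip F (suc n ℕ.∸ i)) i) ⟩
      (mono (suc e) ⊗ flip F (suc n)) 0 ℤ.+ sumTo n (λ i → (mono (suc e) ⊗ flip F (n ℕ.∸ i)) (suc i))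
        ≡⟨ cong₂ ℤ._+_ (mono-suc-⊗-zero e (flip F (suc n))) (sumTo-cong n (λ i → mono-suc-⊗-suc e (flip F (n ℕ.∸ i)) i)) ⟩
      + 0 ℤ.+ diag (λ i j → (mono e ⊗ flip F j) i) n
        ≡⟨ ℤₚ.+-identityˡ _ ⟩
      diag (λ i j → (mono e ⊗ flip F j) i) n
        ≡⟨ at (diag-shift e F) n ⟩
      (mono e ⊗ diag F) n
        ≡⟨ mono-suc-⊗-suc e (diag F) n ⟨
      (mono (suc e) ⊗ diag F) (suc n) ∎ }
  where open ≡-Reasoning

-- Separate bounds k and l allow the largest part to be removed from one partition at a time.
pairs : ℕ → ℕ → (ℕ → ℕ → ℤ) → PS
pairs k l f = diag (λ i j → u k (λ a → u l (f a) j) i)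

pairs-cong : ∀ k l {f g} → (∀ a b → f a b ≡ g a b) → pairs k l f ≈ pairs k l g
pairs-cong k l h = diag-cong (λ i j → u-cong k (λ a → u-cong l (h a) j) i)

pairs-flip : ∀ k l f → pairs k l f ≈ pairs l k (flip f)
pairs-flip k l f = ≈-trans (diag-flip (λ i j → u k (λ a → u l (f a) j) i))
  (diag-cong (λ i j → ∑-swap (λ π π′ → f (length π) (length π′)) (partsLE k j) (partsLE l i)))

pairs-recˡ : ∀ k l f → pairs (suc k) l f ≈ pairs k l f ⊕ mono (suc k) ⊗ pairs (suc k) l (f ∘ suc)
pairs-recˡ k l f = begin
  pairs (suc k) l f
    ≈⟨ diag-cong (λ i j → at (u-rec k (λ a → u l (f a) j)) i) ⟩
  diag (λ i j → u k (λ a → u l (f a) j) i ℤ.+ (mono (suc k) ⊗ u (suc k) (λ a → u l (f (suc a)) j)) i)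
    ≈⟨ mk (λ n → sumTo-+ n (λ i → u k (λ a → u l (f a) (n ℕ.∸ i)) i) (λ i → (mono (suc k) ⊗ u (suc k) (λ a → u l (f (suc a)) (n ℕ.∸ i))) i)) ⟩
  pairs k l f ⊕ diag (λ i j → (mono (suc k) ⊗ u (suc k) (λ a → u l (f (suc a)) j)) i)
    ≈⟨ ⊕-congˡ (pairs k l f) (diag-shift (suc k) (λ i j → u (suc k) (λ a → u l (f (suc a)) j) i)) ⟩
  pairs k l f ⊕ mono (suc k) ⊗ pairs (suc k) l (f ∘ suc) ∎
  where open ≈-Reasoning

pairs-recʳ : ∀ k l f → pairs k (suc l) f ≈ pairs k l f ⊕ mono (suc l) ⊗ pairs k (suc l) (λ a b → f a (suc b))
pairs-recʳ k l f = ≈-trans (pairs-flip k (suc l) f) (≈-trans (pairs-recˡ l k (flip f))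
  (⊕-cong (pairs-flip l k (flip f)) (⊗-congˡ (mono (suc l)) (pairs-flip (suc l) k (flip f ∘ suc)))))

-- The crank series and its closed form

δ : ℤ → ℤ → ℤ
δ m x = if does (x ℤ.≟ m) then + 1 else + 0

δ-cong : ∀ {m x m′ x′} → (x ≡ m → x′ ≡ m′) → (x′ ≡ m′ → x ≡ m) → δ m x ≡ δ m′ x′
δ-cong {m} {x} {m′} {x′} to from with x ℤ.≟ m
... | yes p rewrite dec-true (x′ ℤ.≟ m′) (to p) = refl
... | no ¬p rewrite dec-false (x′ ℤ.≟ m′) (¬p ∘ from) = refl

-- The coefficient of zᵐ in 1/((zq)_N (q/z)_N).
K : ℕ → ℤ → PS
K N m = pairs N N (λ a b → δ m (+ a ℤ.- + b))

δ-sucˡ : ∀ m a b → δ m (+ suc a ℤ.- + b) ≡ δ (ℤ.pred m) (+ a ℤ.- + b)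
δ-sucˡ m a b = δ-cong
  (λ p → trans (solve 2 (λ a b → a :- b := con (ℤ.- + 1) :+ (con (+ 1) :+ a :- b)) refl (+ a) (+ b)) (cong ℤ.pred p))
  (λ p → trans (solve 2 (λ a b → con (+ 1) :+ a :- b := con (+ 1) :+ (a :- b)) refl (+ a) (+ b)) (trans (cong ℤ.suc p) (ℤₚ.suc-pred m)))
  where open ZS

δ-sucʳ : ∀ m a b → δ m (+ a ℤ.- + suc b) ≡ δ (ℤ.suc m) (+ a ℤ.- + b)
δ-sucʳ m a b = δ-cong
  (λ p → trans (solve 2 (λ a b → a :- b := con (+ 1) :+ (a :- (con (+ 1) :+ b))) refl (+ a) (+ b)) (cong ℤ.suc p))
  (λ p → trans (solve 2 (λ a b → a :- (con (+ 1) :+ b) := con (ℤ.- + 1) :+ (a :- b)) refl (+ a) (+ b)) (trans (cong ℤ.pred p) (ℤₚ.pred-suc m)))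
  where open ZS

K-rec : ∀ N → Rec (suc N) (K (suc N)) (K N)
K-rec N m = begin
  X m ⊕ Q ⊗ Q ⊗ X m
    ≈⟨ ⊕-congʳ (Q ⊗ Q ⊗ X m) (≈-trans (left m) (⊕-congʳ (Q ⊗ X (ℤ.pred m)) (right m))) ⟩
  (K N m ⊕ Q ⊗ H (ℤ.suc m)) ⊕ Q ⊗ X (ℤ.pred m) ⊕ Q ⊗ Q ⊗ X m
    -- The extra term Q² X(m) completes Q H(m+1) to Q X(m+1), by `left` at m + 1; this eliminates
    -- the intermediate H, in which only the bound on the first partition is lowered.
    ≈⟨ solve 5 (λ k q h p x → (k :+ q :* h) :+ q :* p :+ q :* q :* x := k :+ q :* (p :+ (h :+ q :* x))) ≈-refl
         (K N m) Q (H (ℤ.suc m)) (X (ℤ.pred m)) (X m) ⟩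
  K N m ⊕ Q ⊗ (X (ℤ.pred m) ⊕ (H (ℤ.suc m) ⊕ Q ⊗ X m))
    ≈⟨ ⊕-congˡ (K N m) (⊗-congˡ Q (⊕-congˡ (X (ℤ.pred m))
         (≈-trans (left (ℤ.suc m)) (⊕-congˡ (H (ℤ.suc m)) (⊗-congˡ Q (≈-reflexive (cong X (ℤₚ.pred-suc m)))))))) ⟨
  K N m ⊕ Q ⊗ (X (ℤ.pred m) ⊕ X (ℤ.suc m)) ∎
  where
  open ≈-Reasoning
  open PSolver
  Q = mono (suc N)
  X = K (suc N)
  H : ℤ → PS
  H m = pairs N (suc N) (λ a b → δ m (+ a ℤ.- + b))
  left : ∀ m → X m ≈ H m ⊕ Q ⊗ X (ℤ.pred m)
  left m = ≈-trans (pairs-recˡ N (suc N) (λ a b → δ m (+ a ℤ.- + b)))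
    (⊕-congˡ (H m) (⊗-congˡ Q (pairs-cong (suc N) (suc N) (δ-sucˡ m))))
  right : ∀ m → H m ≈ K N m ⊕ Q ⊗ H (ℤ.suc m)
  right m = ≈-trans (pairs-recʳ N N (λ a b → δ m (+ a ℤ.- + b)))
    (⊕-congˡ (K N m) (⊗-congˡ Q (pairs-cong N (suc N) (δ-sucʳ m))))

K-0 : ∀ m → K 0 m ≈ cst (δ m (+ 0))
K-0 m = mk λ
  { zero → trans (ℤₚ.+-identityʳ _) (ℤₚ.+-identityʳ _)
  ; (suc n) → trans (sumTo-head n _) (cong (ℤ._+_ (+ 0)) (sumTo-zero n (λ _ _ → refl))) }

-- The inhomogeneous term in the recurrence for `d (suc N)` is `d N` plus the defect at m = 0. The
-- hypothesis identifies it with `K N`, so that N = 0 (defect 1) and N > 0 (defect 0) are treated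
-- alike.
d-rec : ∀ N → (∀ m → K N m ≈ d N ℤ.∣ m ∣ ⊕ (if does (m ℤ.≟ + 0) then ΣPS (suc N) (resid N) else zeroPS)) →
  Rec (suc N) (λ m → d (suc N) ℤ.∣ m ∣) (K N)
d-rec N h (+ zero) = ≈-trans (d-rec-zero N)
  (⊕-congʳ (mono (suc N) ⊗ (d (suc N) 1 ⊕ d (suc N) 1)) (≈-sym (h (+ 0))))
d-rec N h (+ suc m) = ≈-trans (d-rec-suc N m)
  (⊕-congʳ (mono (suc N) ⊗ (d (suc N) m ⊕ d (suc N) (suc (suc m))))
    (≈-sym (≈-trans (h (+ suc m)) (⊕-identityʳ (d N (suc m))))))
d-rec N h -[1+ m ] = ≈-trans (d-rec-suc N m)
  (⊕-cong (≈-sym (≈-trans (h -[1+ m ]) (⊕-identityʳ (d N (suc m)))))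
    (⊗-congˡ (mono (suc N)) (≈-trans (mk λ n → ℤₚ.+-comm (d (suc N) m n) (d (suc N) (suc (suc m)) n))
      (⊕-congˡ (d (suc N) (suc (suc m))) (≈-reflexive (cong (d (suc N)) (sym (abs m))))))))
  where
  abs : ∀ m → ℤ.∣ ℤ.suc -[1+ m ] ∣ ≡ m
  abs zero = refl
  abs (suc m) = refl

-- `K` and `d` solve the same recurrence over `K N`. The induction on N runs through `base`, which
-- supplies the inhomogeneous term.
K-formula : ∀ N m → K (suc N) m ≈ d (suc N) ℤ.∣ m ∣
K-formula N = Rec-unique N (K (suc N)) (λ m → d (suc N) ℤ.∣ m ∣) (K N) (K-rec N) (d-rec N (base N))
  where
  base : ∀ N m → K N m ≈ d N ℤ.∣ m ∣ ⊕ (if does (m ℤ.≟ + 0) then ΣPS (suc N) (resid N) else zeroPS)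
  base zero m with m ℤ.≟ + 0
  ... | yes refl = ≈-trans (K-0 (+ 0)) (≈-sym (≈-trans (⊕-identityˡ (ΣPS 1 (resid 0))) Σresid-zero))
  ... | no m≢0 = ≈-trans (K-0 m) (≈-trans (≈-reflexive (cong (λ b → cst (if b then + 1 else + 0)) (dec-false (+ 0 ℤ.≟ m) (m≢0 ∘ sym)))) cst-0)
  base (suc N) m = ≈-trans (K-formula N m) (≈-sym (≈-trans (⊕-congˡ (d (suc N) ℤ.∣ m ∣) zero-resid) (⊕-identityʳ (d (suc N) ℤ.∣ m ∣))))
    where
    zero-resid : (if does (m ℤ.≟ + 0) then ΣPS (suc (suc N)) (resid (suc N)) else zeroPS) ≈ zeroPS
    zero-resid with does (m ℤ.≟ + 0)
    ... | true = Σresid-suc N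
    ... | false = ≈-refl

-- The generating function of the weighted triples

distinct-gf : ∀ N → (λ n → ∑ (sgn ∘ length) (distinctLE N n)) ≈ qpoch N
distinct-gf zero = mk λ { zero → refl ; (suc n) → refl }
distinct-gf (suc k) = begin
  E (suc k)
    ≈⟨ mk step ⟩
  E k ⊕ cst (ℤ.- + 1) ⊗ (mono (suc k) ⊗ E k)
    ≈⟨ solve 2 (λ e m → e :+ con (ℤ.- + 1) :* (m :* e) := e :* (con (+ 1) :+ con (ℤ.- + 1) :* m)) ≈-refl (E k) (mono (suc k)) ⟩
  E k ⊗ oneMinusQ (suc k)
    ≈⟨ ⊗-congʳ (oneMinusQ (suc k)) (distinct-gf k) ⟩
  qpoch (suc k) ∎
  where
  open ≈-Reasoning
  open PSolver
  E : ℕ → PS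
  E N n = ∑ (sgn ∘ length) (distinctLE N n)
  rest : ∀ n → ∑ (sgn ∘ length) (if suc k ≤ᵇ n then map (suc k ∷_) (distinctLE k (n ℕ.∸ suc k)) else [])
    ≡ ℤ.- + 1 ℤ.* (mono (suc k) ⊗ E k) n
  rest n with suc k ℕ.≤? n
  ... | yes p rewrite ≤ᵇ-true p | mono-⊗-≥ (suc k) (E k) n p =
    trans (∑-map (sgn ∘ length) (suc k ∷_) (distinctLE k (n ℕ.∸ suc k)))
      (trans (∑-cong (λ π → sym (ℤₚ.-1*i≡-i (sgn (length π)))) (distinctLE k (n ℕ.∸ suc k)))
        (∑-*ˡ (ℤ.- + 1) (sgn ∘ length) (distinctLE k (n ℕ.∸ suc k))))
  ... | no p rewrite ≤ᵇ-false (ℕₚ.≰⇒> p) | mono-⊗-< (suc k) (E k) n (ℕₚ.≰⇒> p) = refl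
  step : ∀ n → E (suc k) n ≡ (E k ⊕ cst (ℤ.- + 1) ⊗ (mono (suc k) ⊗ E k)) n
  step n = trans (∑-++ (sgn ∘ length) (distinctLE k n) _)
    (cong (ℤ._+_ (E k n)) (trans (rest n) (sym (cst-⊗ (ℤ.- + 1) (mono (suc k) ⊗ E k) n))))

-- The sign depends on π₁ alone and the crank on π₂, π₃ alone, so the sum factors. `L₃` to `L₀` are
-- the nested lists in `S₂`, from the inside out.
M-S₂-gf : ∀ N m → M-S₂ N m ≈ qpoch N ⊗ K N m
M-S₂-gf N m = ≈-trans (mk unfold) (⊗-congʳ (K N m) (distinct-gf N))
  where
  open ≡-Reasoning
  g : Triple → ℤ
  g t = if does (crank t ℤ.≟ m) then weight t else + 0
  g-split : ∀ π₁ π₂ π₃ → g (π₁ , π₂ , π₃) ≡ sgn (length π₁) ℤ.* δ m (+ length π₂ ℤ.- + length π₃)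
  g-split π₁ π₂ π₃ with does ((+ length π₂ ℤ.- + length π₃) ℤ.≟ m)
  ... | true = sym (ℤₚ.*-identityʳ _)
  ... | false = sym (ℤₚ.*-zeroʳ (sgn (length π₁)))
  E : PS
  E n = ∑ (sgn ∘ length) (distinctLE N n)
  F : ℕ → ℕ → ℤ
  F i j = u N (λ a → u N (λ b → δ m (+ a ℤ.- + b)) j) i
  L₃ : List ℕ → ℕ → List ℕ → List Triple
  L₃ π₁ k π₂ = map (λ π₃ → (π₁ , π₂ , π₃)) (partsLE N k)
  L₂ : ℕ → ℕ → List ℕ → List Triple
  L₂ j k π₁ = concatMap (L₃ π₁ k) (partsLE N j)
  L₁ : ℕ → ℕ → ℕ → List Triple
  L₁ i j k = concatMap (L₂ j k) (distinctLE N i)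
  sum₃ : ∀ π₁ k π₂ → ∑ g (L₃ π₁ k π₂) ≡ sgn (length π₁) ℤ.* u N (λ b → δ m (+ length π₂ ℤ.- + b)) k
  sum₃ π₁ k π₂ = trans (∑-map g (λ π₃ → (π₁ , π₂ , π₃)) (partsLE N k))
    (trans (∑-cong (g-split π₁ π₂) (partsLE N k))
           (∑-*ˡ (sgn (length π₁)) (λ π₃ → δ m (+ length π₂ ℤ.- + length π₃)) (partsLE N k)))
  sum₂ : ∀ j k π₁ → ∑ g (L₂ j k π₁) ≡ sgn (length π₁) ℤ.* F j k
  sum₂ j k π₁ = trans (∑-concatMap g (L₃ π₁ k) (partsLE N j))
    (trans (∑-cong (sum₃ π₁ k) (partsLE N j))
           (∑-*ˡ (sgn (length π₁)) (λ π₂ → u N (λ b → δ m (+ length π₂ ℤ.- + b)) k) (partsLE N j)))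
  sum₁ : ∀ i j k → ∑ g (L₁ i j k) ≡ E i ℤ.* F j k
  sum₁ i j k = trans (∑-concatMap g (L₂ j k) (distinctLE N i))
    (trans (∑-cong (sum₂ j k) (distinctLE N i)) (∑-*ʳ (F j k) (sgn ∘ length) (distinctLE N i)))
  L₀ : ℕ → ℕ → List Triple
  L₀ n i = concatMap (λ j → L₁ i j (n ℕ.∸ i ℕ.∸ j)) (upTo (suc (n ℕ.∸ i)))
  sum₀ : ∀ n i → ∑ g (L₀ n i) ≡ E i ℤ.* K N m (n ℕ.∸ i)
  sum₀ n i = begin
    ∑ g (L₀ n i)
      ≡⟨ ∑-concatMap g (λ j → L₁ i j (n ℕ.∸ i ℕ.∸ j)) (upTo (suc (n ℕ.∸ i))) ⟩
    ∑ (λ j → ∑ g (L₁ i j (n ℕ.∸ i ℕ.∸ j))) (upTo (suc (n ℕ.∸ i)))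
      ≡⟨ ∑-applyUpTo (n ℕ.∸ i) (λ j → ∑ g (L₁ i j (n ℕ.∸ i ℕ.∸ j))) id ⟩
    sumTo (n ℕ.∸ i) (λ j → ∑ g (L₁ i j (n ℕ.∸ i ℕ.∸ j)))
      ≡⟨ sumTo-cong (n ℕ.∸ i) (λ j → sum₁ i j (n ℕ.∸ i ℕ.∸ j)) ⟩
    sumTo (n ℕ.∸ i) (λ j → E i ℤ.* F j (n ℕ.∸ i ℕ.∸ j))
      ≡⟨ sumTo-*ˡ (n ℕ.∸ i) (E i) (λ j → F j (n ℕ.∸ i ℕ.∸ j)) ⟩
    E i ℤ.* K N m (n ℕ.∸ i) ∎
  unfold : ∀ n → M-S₂ N m n ≡ (E ⊗ K N m) n
  unfold n = begin
    M-S₂ N m n                               ≡⟨ ∑-concatMap g (L₀ n) (upTo (suc n)) ⟩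
    ∑ (λ i → ∑ g (L₀ n i)) (upTo (suc n))    ≡⟨ ∑-applyUpTo n (λ i → ∑ g (L₀ n i)) id ⟩
    sumTo n (λ i → ∑ g (L₀ n i))             ≡⟨ sumTo-cong n (sum₀ n) ⟩
    (E ⊗ K N m) n                            ∎

-- Binomial weights and their generating function

-- `falling` is defined by adjoining its smallest factor; here the largest one is split off.
falling-1+ : ∀ x k → falling (+ 1 ℤ.+ x) (suc k) ≡ (+ 1 ℤ.+ x) ℤ.* falling x k
falling-1+ x zero = solve 1 (λ x → con (+ 1) :* (con (+ 1) :+ x :- con (+ 0)) := (con (+ 1) :+ x) :* con (+ 1)) refl x
  where open ZS
falling-1+ x (suc k) = trans (cong (ℤ._* (+ 1 ℤ.+ x ℤ.- + suc k)) (falling-1+ x k))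
  (solve 3 (λ x f k → (con (+ 1) :+ x) :* f :* (con (+ 1) :+ x :- (con (+ 1) :+ k)) := (con (+ 1) :+ x) :* (f :* (x :- k)))
    refl x (falling x k) (+ k))
  where open ZS

falling-0 : ∀ k → falling (+ 0) (suc k) ≡ + 0
falling-0 zero = refl
falling-0 (suc k) = cong (ℤ._* (+ 0 ℤ.- + suc k)) (falling-0 k)

-- Negating the k factors y, ..., y - k + 1 and reversing their order gives the factors of the
-- falling factorial at k - 1 - y.
falling-reflect : ∀ y k → falling y k ≡ sgn k ℤ.* falling (+ k ℤ.- + 1 ℤ.- y) k
falling-reflect y zero = refl
falling-reflect y (suc k) = begin
  falling y k ℤ.* (y ℤ.- + k)
    ≡⟨ cong (ℤ._* (y ℤ.- + k)) (falling-reflect y k) ⟩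
  sgn k ℤ.* falling z k ℤ.* (y ℤ.- + k)
    ≡⟨ solve 4 (λ s f y k → s :* f :* (y :- k) := (:- s) :* ((con (+ 1) :+ (k :- con (+ 1) :- y)) :* f)) refl (sgn k) (falling z k) y (+ k) ⟩
  ℤ.- sgn k ℤ.* ((+ 1 ℤ.+ z) ℤ.* falling z k)
    ≡⟨ cong (ℤ._*_ (ℤ.- sgn k)) (falling-1+ z k) ⟨
  ℤ.- sgn k ℤ.* falling (+ 1 ℤ.+ z) (suc k)
    ≡⟨ cong (λ t → ℤ.- sgn k ℤ.* falling t (suc k))
         (solve 2 (λ k y → con (+ 1) :+ (k :- con (+ 1) :- y) := con (+ 1) :+ k :- con (+ 1) :- y) refl (+ k) y) ⟩
  ℤ.- sgn k ℤ.* falling (+ suc k ℤ.- + 1 ℤ.- y) (suc k) ∎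
  where
  open ≡-Reasoning
  open ZS
  z = + k ℤ.- + 1 ℤ.- y

sgn-double : ∀ a → sgn (2 ℕ.* a) ≡ + 1
sgn-double zero = refl
sgn-double (suc a) rewrite ℕₚ.+-suc a (a ℕ.+ 0) = trans (ℤₚ.neg-involutive (sgn (2 ℕ.* a))) (sgn-double a)

-- Pascal's recursion is what the generating function uses, whence not Data.Nat.Combinatorics._C_.
ch : ℕ → ℕ → ℕ
ch _ zero = 1
ch zero (suc k) = 0
ch (suc n) (suc k) = ch n k ℕ.+ ch n (suc k)

ch-< : ∀ {n k} → n < k → ch n k ≡ 0
ch-< {zero} {suc k} _ = refl
ch-< {suc n} {suc k} (s≤s p) = cong₂ ℕ._+_ (ch-< p) (ch-< (ℕₚ.m≤n⇒m≤1+n p))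

falling-ch : ∀ a k → falling (+ a) k ≡ + (ch a k ℕ.* k !)
falling-ch a zero = refl
falling-ch zero (suc k) = falling-0 k
falling-ch (suc a) (suc k) = begin
  falling (+ suc a) (suc k)
    ≡⟨ falling-1+ (+ a) k ⟩
  + suc a ℤ.* falling (+ a) k
    -- Writing 1 + a = (a - k) + (1 + k) produces the two terms of Pascal's recursion.
    ≡⟨ solve 3 (λ a k f → (con (+ 1) :+ a) :* f := f :* (a :- k) :+ (con (+ 1) :+ k) :* f) refl (+ a) (+ k) (falling (+ a) k) ⟩
  falling (+ a) (suc k) ℤ.+ + suc k ℤ.* falling (+ a) k
    ≡⟨ cong₂ (λ x y → x ℤ.+ + suc k ℤ.* y) (falling-ch a (suc k)) (falling-ch a k) ⟩
  + (ch a (suc k) ℕ.* (suc k) !) ℤ.+ + suc k ℤ.* + (ch a k ℕ.* k !)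
    ≡⟨ cong (ℤ._+_ (+ (ch a (suc k) ℕ.* (suc k) !))) (sym (ℤₚ.pos-* (suc k) (ch a k ℕ.* k !))) ⟩
  + (ch a (suc k) ℕ.* (suc k) ! ℕ.+ suc k ℕ.* (ch a k ℕ.* k !))
    ≡⟨ cong +_ (NS.solve 4 (λ c d k f → c NS.:* ((NS.con 1 NS.:+ k) NS.:* f) NS.:+ (NS.con 1 NS.:+ k) NS.:* (d NS.:* f)
         NS.:= (d NS.:+ c) NS.:* ((NS.con 1 NS.:+ k) NS.:* f)) refl (ch a (suc k)) (ch a k) k (k !)) ⟩
  + (ch (suc a) (suc k) ℕ.* (suc k) !) ∎
  where
  open ≡-Reasoning
  open ZS
  module NS = ℕSolver.+-*-Solver

binomℤ-ch : ∀ a k → binomℤ (+ a) k ≡ + ch a k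
binomℤ-ch a k rewrite falling-ch a k = cong +_ (DivMod.m*n/n≡m (ch a k) (k !) {{k ℕₚ.!≢0}})

-- The lower index is even, so the reflection has no sign and the dividends already agree.
binomℤ-reflect : ∀ y a → binomℤ y (2 ℕ.* a) ≡ binomℤ (+ (2 ℕ.* a) ℤ.- + 1 ℤ.- y) (2 ℕ.* a)
binomℤ-reflect y a = cong (λ t → ℤ._/ℕ_ t ((2 ℕ.* a) !) {{(2 ℕ.* a) ℕₚ.!≢0}})
  (trans (falling-reflect y (2 ℕ.* a)) (trans (cong (ℤ._* falling z (2 ℕ.* a)) (sgn-double a)) (ℤₚ.*-identityˡ _)))
  where z = + (2 ℕ.* a) ℤ.- + 1 ℤ.- y

-- Weighted sums over the crank

fold± : (ℤ → ℤ) → ℕ → ℤ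
fold± f zero = f (+ 0)
fold± f (suc m) = f (+ suc m) ℤ.+ f -[1+ m ]

∑-rangeℤ : ∀ n (f : ℤ → ℤ) → ∑ f (rangeℤ (ℤ.- + n) (+ n)) ≡ sumTo n (fold± f)
∑-rangeℤ n f = trans (cong (λ k → ∑ f (applyUpTo (λ i → ℤ.- + n ℤ.+ + i) k)) len) (trans (∑-applyUpTo (n ℕ.+ n) f (λ i → ℤ.- + n ℤ.+ + i)) (go n))
  where
  open ≡-Reasoning
  len : ℤ.∣ (+ n ℤ.+ + 1) ℤ.- (ℤ.- + n) ∣ ≡ suc (n ℕ.+ n)
  len = cong ℤ.∣_∣ (ZS.solve 1 (λ n → n ZS.:+ ZS.con (+ 1) ZS.:- (ZS.:- n) ZS.:= ZS.con (+ 1) ZS.:+ (n ZS.:+ n)) refl (+ n))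
  go : ∀ n → sumTo (n ℕ.+ n) (λ i → f (ℤ.- + n ℤ.+ + i)) ≡ sumTo n (fold± f)
  go zero = refl
  go (suc n) rewrite ℕₚ.+-suc n n = begin
    sumTo (suc (n ℕ.+ n)) h ℤ.+ h (suc (suc (n ℕ.+ n)))
      ≡⟨ cong₂ ℤ._+_ (sumTo-head (n ℕ.+ n) h) (cong f (solve 1 (λ n → (:- (con (+ 1) :+ n)) :+ (con (+ 2) :+ (n :+ n)) := con (+ 1) :+ n) refl (+ n))) ⟩
    f -[1+ n ] ℤ.+ sumTo (n ℕ.+ n) (h ∘ suc) ℤ.+ f (+ suc n)
      ≡⟨ cong (λ t → f -[1+ n ] ℤ.+ t ℤ.+ f (+ suc n)) (trans (sumTo-cong (n ℕ.+ n) (λ i → cong f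
           (solve 2 (λ n i → (:- (con (+ 1) :+ n)) :+ (con (+ 1) :+ i) := (:- n) :+ i) refl (+ n) (+ i)))) (go n)) ⟩
    f -[1+ n ] ℤ.+ sumTo n (fold± f) ℤ.+ f (+ suc n)
      ≡⟨ solve 3 (λ a b c → a :+ b :+ c := b :+ (c :+ a)) refl (f -[1+ n ]) (sumTo n (fold± f)) (f (+ suc n)) ⟩
    sumTo n (fold± f) ℤ.+ (f (+ suc n) ℤ.+ f -[1+ n ]) ∎
    where
    open ZS
    h : ℕ → ℤ
    h i = f (-[1+ n ] ℤ.+ + i)

-- The series Σ_m b m · X m, for X m divisible by qᵐ.
Lim : (ℕ → ℤ) → (ℕ → PS) → PS
Lim b X n = sumTo n (λ m → b m ℤ.* X m n)

Lim-cong : ∀ {b b′ X X′} → (∀ m → b m ≡ b′ m) → (∀ m → X m ≈ X′ m) → Lim b X ≈ Lim b′ X′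
Lim-cong h k = mk λ n → sumTo-cong n (λ m → cong₂ ℤ._*_ (h m) (at (k m) n))

Lim-+ : ∀ b b′ X → Lim (λ m → b m ℤ.+ b′ m) X ≈ Lim b X ⊕ Lim b′ X
Lim-+ b b′ X = mk λ n → trans
  (sumTo-cong n (λ m → ℤₚ.*-distribʳ-+ (X m n) (b m) (b′ m)))
  (sumTo-+ n (λ m → b m ℤ.* X m n) (λ m → b′ m ℤ.* X m n))

Lim-⊗ : ∀ b Y {Z : ℕ → PS} → (∀ m k → k < m → Z m k ≡ + 0) → Lim b (λ m → Y ⊗ Z m) ≈ Y ⊗ Lim b Z
Lim-⊗ b Y {Z} ord = mk λ n → begin
  sumTo n (λ m → b m ℤ.* sumTo n (λ i → Y i ℤ.* Z m (n ℕ.∸ i)))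
    ≡⟨ sumTo-cong n (λ m → sym (sumTo-*ˡ n (b m) (λ i → Y i ℤ.* Z m (n ℕ.∸ i)))) ⟩
  sumTo n (λ m → sumTo n (λ i → b m ℤ.* (Y i ℤ.* Z m (n ℕ.∸ i))))
    ≡⟨ sumTo-swap n n (λ m i → b m ℤ.* (Y i ℤ.* Z m (n ℕ.∸ i))) ⟩
  sumTo n (λ i → sumTo n (λ m → b m ℤ.* (Y i ℤ.* Z m (n ℕ.∸ i))))
    ≡⟨ sumTo-cong n (λ i → trans
         (sumTo-cong n (λ m → ZS.solve 3 (λ b y z → b ZS.:* (y ZS.:* z) ZS.:= y ZS.:* (b ZS.:* z)) refl (b m) (Y i) (Z m (n ℕ.∸ i))))
         (trans (sumTo-*ˡ n (Y i) (λ m → b m ℤ.* Z m (n ℕ.∸ i)))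
                -- The inner sum runs to m = n, but the coefficient at n - i only sees m ≤ n - i, by
                -- the divisibility hypothesis.
                (cong (ℤ._*_ (Y i)) (sumTo-extend (λ m → b m ℤ.* Z m (n ℕ.∸ i)) (ℕₚ.m∸n≤m n i)
                  (λ m lt → trans (cong (ℤ._*_ (b m)) (ord m (n ℕ.∸ i) lt)) (ℤₚ.*-zeroʳ (b m))))))) ⟩
  sumTo n (λ i → Y i ℤ.* Lim b Z (n ℕ.∸ i)) ∎
  where open ≡-Reasoning

Lim-ΣPS : ∀ b N (X : ℕ → ℕ → PS) → Lim b (λ m → ΣPS N (X m)) ≈ ΣPS N (λ n → Lim b (λ m → X m n))
Lim-ΣPS b zero X = mk λ n → sumTo-zero n (λ m _ → ℤₚ.*-zeroʳ (b m))
Lim-ΣPS b (suc N) X = ≈-trans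
  (mk λ n → trans (sumTo-cong n (λ m → ℤₚ.*-distribˡ-+ (b m) (ΣPS N (X m) n) (X m (suc N) n)))
                  (sumTo-+ n (λ m → b m ℤ.* ΣPS N (X m) n) (λ m → b m ℤ.* X m (suc N) n)))
  (⊕-congʳ (Lim b (λ m → X m (suc N))) (Lim-ΣPS b N X))

mono-< : ∀ {e n} → n < e → mono e n ≡ + 0
mono-< {suc e} {zero} _ = refl
mono-< {suc e} {suc n} (s≤s p) = mono-< p

-- Σ_m b m · xᵐ at x = q^{j+1}.
g : ℕ → (ℕ → ℤ) → PS
g j b = Lim b (λ m → mono (suc j ℕ.* m))

mono-order : ∀ j m k → k < m → mono (suc j ℕ.* m) k ≡ + 0
mono-order j m k k<m = mono-< (ℕₚ.<-≤-trans k<m (ℕₚ.m≤m+n m (j ℕ.* m)))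

g-cong : ∀ j {b b′} → (∀ m → b m ≡ b′ m) → g j b ≈ g j b′
g-cong j h = Lim-cong h (λ m → ≈-refl)

g-step : ∀ j b → g j b ≈ cst (b 0) ⊕ mono (suc j) ⊗ g j (b ∘ suc)
g-step j b = mk λ
  { zero → begin
      b 0 ℤ.* mono (suc j ℕ.* 0) 0
        ≡⟨ trans (cong (λ e → b 0 ℤ.* mono e 0) (ℕₚ.*-zeroʳ (suc j))) (ℤₚ.*-identityʳ (b 0)) ⟩
      b 0
        ≡⟨ ℤₚ.+-identityʳ (b 0) ⟨
      b 0 ℤ.+ + 0
        ≡⟨ cong (ℤ._+_ (b 0)) (mono-suc-⊗-zero j (g j (b ∘ suc))) ⟨
      b 0 ℤ.+ (mono (suc j) ⊗ g j (b ∘ suc)) 0 ∎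
  ; (suc n) → begin
      g j b (suc n)
        ≡⟨ sumTo-head n (λ m → b m ℤ.* mono (suc j ℕ.* m) (suc n)) ⟩
      b 0 ℤ.* mono (suc j ℕ.* 0) (suc n) ℤ.+ sumTo n (h n)
        ≡⟨ cong (ℤ._+ sumTo n (h n)) (trans (cong (λ e → b 0 ℤ.* mono e (suc n)) (ℕₚ.*-zeroʳ (suc j))) (ℤₚ.*-zeroʳ (b 0))) ⟩
      + 0 ℤ.+ sumTo n (h n)
        ≡⟨ cong (ℤ._+_ (+ 0)) (ℤₚ.+-identityʳ (sumTo n (h n))) ⟨
      + 0 ℤ.+ (sumTo n (h n) ℤ.+ + 0)
        -- `Lim` at index n + 1 has one more term than the sum left after removing the head; its
        -- exponent is at least n + 2, so it vanishes there.
        ≡⟨ cong (λ t → + 0 ℤ.+ (sumTo n (h n) ℤ.+ t)) (trans (cong (ℤ._*_ (b (suc (suc n)))) (mono-order j (suc (suc n)) (suc n) ℕₚ.≤-refl)) (ℤₚ.*-zeroʳ (b (suc (suc n))))) ⟨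
      + 0 ℤ.+ Lim (b ∘ suc) (λ m → mono (suc j ℕ.* suc m)) (suc n)
        ≡⟨ cong (ℤ._+_ (+ 0)) (at (≈-trans (Lim-cong {b ∘ suc} (λ _ → refl) (mono-*-suc (suc j))) (Lim-⊗ (b ∘ suc) (mono (suc j)) (mono-order j))) (suc n)) ⟩
      + 0 ℤ.+ (mono (suc j) ⊗ g j (b ∘ suc)) (suc n) ∎ }
  where
  open ≡-Reasoning
  h : ℕ → ℕ → ℤ
  h n m = b (suc m) ℤ.* mono (suc j ℕ.* suc m) (suc n)

chFrom : ℕ → ℕ → ℕ → ℤ
chFrom a k m = + ch (m ℕ.+ a) k

-- The classical Σ_m C(m, k) xᵐ = xᵏ/(1 - x)^{k+1}. By Pascal's recursion the sums S_k satisfy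
-- S_{k+1} = x(S_k + S_{k+1}).
g-ch₀ : ∀ j k → (oneMinusQ (suc j) ^PS suc k) ⊗ g j (chFrom 0 k) ≈ mono (suc j ℕ.* k)
g-ch₀ j zero = begin
  P ⊗ cst (+ 1) ⊗ C
    ≈⟨ solve 2 (λ x c → (con (+ 1) :+ con (ℤ.- + 1) :* x) :* con (+ 1) :* c := c :- x :* c) ≈-refl x C ⟩
  C ⊕ (⊝ (x ⊗ C))
    ≈⟨ ⊕-congʳ (⊝ (x ⊗ C)) (g-step j (chFrom 0 0)) ⟩
  cst (+ 1) ⊕ x ⊗ C ⊕ (⊝ (x ⊗ C))
    ≈⟨ solve 2 (λ x c → con (+ 1) :+ x :* c :- x :* c := con (+ 1)) ≈-refl x C ⟩
  cst (+ 1)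
    ≈⟨ mono-0 ⟨
  mono 0
    ≈⟨ ≈-reflexive (cong mono (ℕₚ.*-zeroʳ (suc j))) ⟨
  mono (suc j ℕ.* 0) ∎
  where
  open ≈-Reasoning
  open PSolver
  x = mono (suc j)
  P = oneMinusQ (suc j)
  C = g j (chFrom 0 0)
g-ch₀ j (suc k) = begin
  (P ⊗ Pk) ⊗ C′
    ≈⟨ solve 3 (λ x p c → ((con (+ 1) :+ con (ℤ.- + 1) :* x) :* p) :* c := p :* (c :- x :* c)) ≈-refl x Pk C′ ⟩
  Pk ⊗ (C′ ⊕ (⊝ (x ⊗ C′)))
    ≈⟨ ⊗-congˡ Pk (⊕-congʳ (⊝ (x ⊗ C′)) (≈-trans (g-step j (chFrom 0 (suc k)))
         (⊕-congˡ (cst (+ 0)) (⊗-congˡ x (Lim-+ (chFrom 0 k) (chFrom 0 (suc k)) (λ m → mono (suc j ℕ.* m))))))) ⟩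
  Pk ⊗ (cst (+ 0) ⊕ x ⊗ (C ⊕ C′) ⊕ (⊝ (x ⊗ C′)))
    ≈⟨ solve 4 (λ p x c c′ → p :* (con (+ 0) :+ x :* (c :+ c′) :- x :* c′) := x :* (p :* c)) ≈-refl Pk x C C′ ⟩
  x ⊗ (Pk ⊗ C)
    ≈⟨ ⊗-congˡ x (g-ch₀ j k) ⟩
  x ⊗ mono (suc j ℕ.* k)
    ≈⟨ mono-*-suc (suc j) k ⟨
  mono (suc j ℕ.* suc k) ∎
  where
  open ≈-Reasoning
  open PSolver
  x = mono (suc j)
  P = oneMinusQ (suc j)
  Pk = P ^PS suc k
  C = g j (chFrom 0 k)
  C′ = g j (chFrom 0 (suc k))

-- The first a coefficients C(0, k), ..., C(a-1, k) vanish because a ≤ k.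
g-ch-shift : ∀ j a k → a ≤ k → g j (chFrom 0 k) ≈ mono (suc j ℕ.* a) ⊗ g j (chFrom a k)
g-ch-shift j zero k _ = ≈-sym (≈-trans (⊗-congʳ C (≈-trans (≈-reflexive (cong mono (ℕₚ.*-zeroʳ (suc j)))) mono-0)) (⊗-identityˡ C))
  where C = g j (chFrom 0 k)
g-ch-shift j (suc a) k a<k = begin
  g j (chFrom 0 k)
    ≈⟨ g-ch-shift j a k (ℕₚ.<⇒≤ a<k) ⟩
  M ⊗ g j (chFrom a k)
    ≈⟨ ⊗-congˡ M (g-step j (chFrom a k)) ⟩
  M ⊗ (cst (+ ch a k) ⊕ x ⊗ g j (chFrom a k ∘ suc))
    ≈⟨ ⊗-congˡ M (⊕-cong (≈-reflexive (cong (cst ∘ +_) (ch-< a<k))) (⊗-congˡ x (g-cong j (λ m → cong (λ t → + ch t k) (sym (ℕₚ.+-suc m a)))))) ⟩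
  M ⊗ (cst (+ 0) ⊕ x ⊗ C)
    ≈⟨ solve 3 (λ m x c → m :* (con (+ 0) :+ x :* c) := x :* m :* c) ≈-refl M x C ⟩
  x ⊗ M ⊗ C
    ≈⟨ ⊗-congʳ C (mono-*-suc (suc j) a) ⟨
  mono (suc j ℕ.* suc a) ⊗ C ∎
  where
  open ≈-Reasoning
  open PSolver
  x = mono (suc j)
  M = mono (suc j ℕ.* a)
  C = g j (chFrom (suc a) k)

g-ch : ∀ j a c {k} → a ℕ.+ c ≡ k → (oneMinusQ (suc j) ^PS suc k) ⊗ g j (chFrom a k) ≈ mono (suc j ℕ.* c)
g-ch j a c refl = mono-cancel (suc j ℕ.* a) (begin
  M ⊗ (P ⊗ C)
    ≈⟨ solve 3 (λ m p c → m :* (p :* c) := p :* (m :* c)) ≈-refl M P C ⟩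
  P ⊗ (M ⊗ C)
    ≈⟨ ⊗-congˡ P (g-ch-shift j a (a ℕ.+ c) (ℕₚ.m≤m+n a c)) ⟨
  P ⊗ g j (chFrom 0 (a ℕ.+ c))
    ≈⟨ g-ch₀ j (a ℕ.+ c) ⟩
  mono (suc j ℕ.* (a ℕ.+ c))
    ≈⟨ ≈-reflexive (cong mono (ℕₚ.*-distribˡ-+ (suc j) a c)) ⟩
  mono (suc j ℕ.* a ℕ.+ suc j ℕ.* c)
    ≈⟨ mono-+ (suc j ℕ.* a) (suc j ℕ.* c) ⟩
  M ⊗ mono (suc j ℕ.* c) ∎)
  where
  open ≈-Reasoning
  open PSolver
  M = mono (suc j ℕ.* a)
  P = oneMinusQ (suc j) ^PS suc (a ℕ.+ c)
  C = g j (chFrom a (a ℕ.+ c))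

-- With ν = v + 1, the joint weight of the cranks m and -m. Both summands vanish at m = 0, so
-- counting that crank twice is harmless.
b± : ℕ → ℕ → ℤ
b± v m = chFrom v (2 ℕ.* suc v) m ℤ.+ chFrom (suc v) (2 ℕ.* suc v) m

-- The shifts ν - 1 and ν leave x^{ν+1} and x^ν over (1 - x)^{2ν+1}. The factor 1 - x on the left is
-- the one contained in `w`.
g-b± : ∀ j v → let x = mono (suc j) ; ν = suc v in
  oneMinusQ (suc j) ⊗ g j (b± v) ≈ mono (ν ℕ.* suc j) ⊗ (cst (+ 1) ⊕ x) ⊗ inv (oneMinusQ (suc j) ^PS (2 ℕ.* ν))
g-b± j v = divide Pk (^PS₀ P (2 ℕ.* ν) refl) (begin
  Pk ⊗ (P ⊗ g j (b± v))
    ≈⟨ ⊗-congˡ Pk (⊗-congˡ P (Lim-+ (chFrom v (2 ℕ.* ν)) (chFrom ν (2 ℕ.* ν)) (λ m → mono (suc j ℕ.* m)))) ⟩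
  Pk ⊗ (P ⊗ (C₁ ⊕ C₂))
    ≈⟨ solve 4 (λ k p a b → k :* (p :* (a :+ b)) := (p :* k) :* a :+ (p :* k) :* b) ≈-refl Pk P C₁ C₂ ⟩
  (P ⊗ Pk) ⊗ C₁ ⊕ (P ⊗ Pk) ⊗ C₂
    ≈⟨ ⊕-cong (≈-trans (g-ch j v (suc ν) e₁) (mono-*-suc (suc j) ν)) (g-ch j ν ν e₂) ⟩
  x ⊗ mono (suc j ℕ.* ν) ⊕ mono (suc j ℕ.* ν)
    ≈⟨ ⊕-cong (⊗-congˡ x ec) ec ⟩
  x ⊗ M ⊕ M
    ≈⟨ solve 2 (λ x m → x :* m :+ m := m :* (con (+ 1) :+ x)) ≈-refl x M ⟩
  M ⊗ (cst (+ 1) ⊕ x) ∎)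
  where
  open ≈-Reasoning
  open PSolver
  ν = suc v
  x = mono (suc j)
  M = mono (ν ℕ.* suc j)
  P = oneMinusQ (suc j)
  Pk = P ^PS (2 ℕ.* ν)
  C₁ = g j (chFrom v (2 ℕ.* ν))
  C₂ = g j (chFrom ν (2 ℕ.* ν))
  ec : mono (suc j ℕ.* ν) ≈ M
  ec = ≈-reflexive (cong mono (ℕₚ.*-comm (suc j) ν))
  e₂ : ν ℕ.+ ν ≡ 2 ℕ.* ν
  e₂ = cong (ℕ._+_ ν) (sym (ℕₚ.+-identityʳ ν))
  e₁ : v ℕ.+ suc ν ≡ 2 ℕ.* ν
  e₁ = trans (ℕₚ.+-suc v ν) e₂

-- The first equality

μ-b± : ∀ v N n → μ (suc v) (suc N) n ≡ Lim (b± v) (λ m → qpoch (suc N) ⊗ d (suc N) m) n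
μ-b± v N n = begin
  μ (suc v) (suc N) n
    ≡⟨ ∑-cong (λ m → cong (ℤ._*_ (Bn m)) (at (≈-trans (M-S₂-gf (suc N) m) (⊗-congˡ (qpoch (suc N)) (K-formula N m))) n)) (rangeℤ (ℤ.- + n) (+ n)) ⟩
  ∑ (λ m → Bn m ℤ.* c ℤ.∣ m ∣) (rangeℤ (ℤ.- + n) (+ n))
    ≡⟨ ∑-rangeℤ n (λ m → Bn m ℤ.* c ℤ.∣ m ∣) ⟩
  sumTo n (fold± (λ m → Bn m ℤ.* c ℤ.∣ m ∣))
    ≡⟨ sumTo-cong n step ⟩
  sumTo n (λ m → b± v m ℤ.* c m) ∎
  where
  open ≡-Reasoning
  ν = suc v
  c : ℕ → ℤ
  c m = (qpoch (suc N) ⊗ d (suc N) m) n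
  Bn : ℤ → ℤ
  Bn m = binomℤ (m ℤ.+ + ν ℤ.- + 1) (2 ℕ.* ν)
  pos : ∀ m → Bn (+ m) ≡ chFrom v (2 ℕ.* ν) m
  pos m = trans (cong (λ t → binomℤ t (2 ℕ.* ν))
    (ZS.solve 2 (λ m v → m ZS.:+ (ZS.con (+ 1) ZS.:+ v) ZS.:- ZS.con (+ 1) ZS.:= m ZS.:+ v) refl (+ m) (+ v)))
    (binomℤ-ch (m ℕ.+ v) (2 ℕ.* ν))
  neg : ∀ m → Bn (ℤ.- + m) ≡ chFrom ν (2 ℕ.* ν) m
  neg m = trans (binomℤ-reflect (ℤ.- + m ℤ.+ + ν ℤ.- + 1) ν) (trans (cong (λ t → binomℤ t (2 ℕ.* ν))
    (ZS.solve 2 (λ m n → n ZS.:+ (n ZS.:+ ZS.con (+ 0)) ZS.:- ZS.con (+ 1) ZS.:- ((ZS.:- m) ZS.:+ n ZS.:- ZS.con (+ 1)) ZS.:= m ZS.:+ n) refl (+ m) (+ ν)))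
    (binomℤ-ch (m ℕ.+ ν) (2 ℕ.* ν)))
  step : ∀ m → fold± (λ m → Bn m ℤ.* c ℤ.∣ m ∣) m ≡ b± v m ℤ.* c m
  -- The range meets m = 0 once, while `b±` has two summands there; the second is C(ν, 2ν) = 0.
  step zero = cong (ℤ._* c 0) (trans (pos 0) (sym (trans (cong (ℤ._+_ (+ ch v (2 ℕ.* ν))) (cong +_ (ch-< {ν} {2 ℕ.* ν} (s≤s (ℕₚ.m<m+n v (s≤s z≤n)))))) (ℤₚ.+-identityʳ (+ ch v (2 ℕ.* ν))))))
  step (suc m) = trans (sym (ℤₚ.*-distribʳ-+ (c (suc m)) (Bn (+ suc m)) (Bn -[1+ m ]))) (cong (ℤ._* c (suc m)) (cong₂ ℤ._+_ (pos (suc m)) (neg (suc m))))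

tri-double : ∀ n → n ℕ.* (n ℕ.∸ 1) ≡ tri n ℕ.* 2
tri-double zero = refl
tri-double (suc n) = go n
  where
  open ℕSolver.+-*-Solver
  go : ∀ n → suc n ℕ.* n ≡ (tri n ℕ.+ n) ℕ.* 2
  go zero = refl
  go (suc n) = trans (solve 1 (λ n → (con 2 :+ n) :* (con 1 :+ n) := (con 1 :+ n) :* n :+ (con 1 :+ n) :* con 2) refl n)
    (trans (cong (ℕ._+ suc n ℕ.* 2) (go n)) (sym (ℕₚ.*-distribʳ-+ 2 (tri n ℕ.+ n) (suc n))))

tri-half : ∀ n → n ℕ.* (n ℕ.∸ 1) DivMod./ 2 ≡ tri n
tri-half n = trans (cong (DivMod._/ 2) (tri-double n)) (DivMod.m*n/n≡m (tri n) 2)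

d-order : ∀ N m k → k < m → d N m k ≡ + 0
d-order zero m k _ = refl
d-order (suc N) m k k<m = cong₂ ℤ._+_ (ord N) (term N)
  where
  term : ∀ n → (w (suc N) (suc n) ⊗ mono (suc n ℕ.* m)) k ≡ + 0
  term n = trans (at (⊗-comm (w (suc N) (suc n)) (mono (suc n ℕ.* m))) k)
    (mono-⊗-< (suc n ℕ.* m) (w (suc N) (suc n)) k (ℕₚ.<-≤-trans k<m (ℕₚ.m≤m+n m (n ℕ.* m))))
  ord : ∀ L → ΣPS L (λ n → w (suc N) n ⊗ mono (n ℕ.* m)) k ≡ + 0
  ord zero = refl
  ord (suc L) = cong₂ ℤ._+_ (ord L) (term L)

middleTerm : ℕ → ℕ → ℕ → PS
middleTerm ν N n =
  cst (sgn (n ℕ.∸ 1)) ⊗ mono (ℕ._/_ (n ℕ.* (n ℕ.∸ 1)) 2 ℕ.+ ν ℕ.* n)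
      ⊗ (cst (+ 1) ⊕ mono n)
      ⊗ inv (qpoch (N ℕ.+ n)) ⊗ inv (qpoch (N ℕ.∸ n))
      ⊗ inv (oneMinusQ n ^PS (2 ℕ.* ν))

middleTerm-mono : ∀ ν n → mono (ℕ._/_ (n ℕ.* (n ℕ.∸ 1)) 2 ℕ.+ ν ℕ.* n) ≈ mono (tri n) ⊗ mono (ν ℕ.* n)
middleTerm-mono ν n = ≈-trans (≈-reflexive (cong (λ t → mono (t ℕ.+ ν ℕ.* n)) (tri-half n))) (mono-+ (tri n) (ν ℕ.* n))

w-g : ∀ v N j → w N (suc j) ⊗ g j (b± v) ≈ middleTerm (suc v) N (suc j)
w-g v N j = begin
  s ⊗ τ ⊗ P ⊗ (i₁ ⊗ i₂) ⊗ g j (b± v)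
    ≈⟨ solve 6 (λ s τ p i k g → s :* τ :* p :* (i :* k) :* g := s :* τ :* (i :* k) :* (p :* g)) ≈-refl s τ P i₁ i₂ (g j (b± v)) ⟩
  s ⊗ τ ⊗ (i₁ ⊗ i₂) ⊗ (P ⊗ g j (b± v))
    ≈⟨ ⊗-congˡ (s ⊗ τ ⊗ (i₁ ⊗ i₂)) (g-b± j v) ⟩
  s ⊗ τ ⊗ (i₁ ⊗ i₂) ⊗ (M ⊗ y ⊗ I)
    ≈⟨ solve 7 (λ s τ i k m y z → s :* τ :* (i :* k) :* (m :* y :* z) := s :* (τ :* m) :* y :* i :* k :* z) ≈-refl s τ i₁ i₂ M y I ⟩
  s ⊗ (τ ⊗ M) ⊗ y ⊗ i₁ ⊗ i₂ ⊗ I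
    ≈⟨ ⊗-congʳ I (⊗-congʳ i₂ (⊗-congʳ i₁ (⊗-congʳ y (⊗-congˡ s (middleTerm-mono (suc v) (suc j)))))) ⟨
  middleTerm (suc v) N (suc j) ∎
  where
  open ≈-Reasoning
  open PSolver
  s = cst (sgn j)
  τ = mono (tri (suc j))
  P = oneMinusQ (suc j)
  i₁ = inv (qpoch (N ℕ.+ suc j))
  i₂ = inv (qpoch (N ℕ.∸ suc j))
  M = mono (suc v ℕ.* suc j)
  y = cst (+ 1) ⊕ mono (suc j)
  I = inv (P ^PS (2 ℕ.* suc v))

lhs-middle : ∀ v N n → lhsSeries (suc v) (suc N) n ≡ middleSeries (suc v) (suc N) n
lhs-middle v N n = trans (lhs n) (at series n)
  where
  open ≈-Reasoning
  X : ℕ → ℕ → PS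
  X m n = w (suc N) n ⊗ mono (n ℕ.* m)
  lhs : ∀ n → lhsSeries (suc v) (suc N) n ≡ Lim (b± v) (λ m → qpoch (suc N) ⊗ d (suc N) m) n
  -- The left series starts at n = 1, so the constant term on the right has to vanish; it does since
  -- `b± v 0` is 0.
  lhs zero = sym (cong (ℤ._* (qpoch (suc N) ⊗ d (suc N) 0) 0)
    (cong₂ (λ s t → + s ℤ.+ + t) (ch-< {v} {2 ℕ.* suc v} (s≤s (ℕₚ.m≤m+n v _))) (ch-< {suc v} {2 ℕ.* suc v} (s≤s (ℕₚ.m<m+n v (s≤s z≤n))))))
  lhs (suc n) = μ-b± v N (suc n)
  series : Lim (b± v) (λ m → qpoch (suc N) ⊗ d (suc N) m) ≈ middleSeries (suc v) (suc N)
  series = begin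
    Lim (b± v) (λ m → qpoch (suc N) ⊗ d (suc N) m)
      ≈⟨ Lim-⊗ (b± v) (qpoch (suc N)) (d-order (suc N)) ⟩
    qpoch (suc N) ⊗ Lim (b± v) (d (suc N))
      ≈⟨ ⊗-congˡ (qpoch (suc N)) (≈-trans (Lim-ΣPS (b± v) (suc N) X)
           (ΣPS-cong (suc N) (λ j _ → ≈-trans (Lim-⊗ (b± v) (w (suc N) (suc j)) (mono-order j)) (w-g v (suc N) j)))) ⟩
    middleSeries (suc v) (suc N) ∎

-- The bilateral sum

embed-cong : ∀ {f h} → f ≈ h → ∀ i → embed f i ≡ embed h i
embed-cong p (+ n) = at p n
embed-cong p -[1+ n ] = refl

embed-⊕ : ∀ f h i → embed (f ⊕ h) i ≡ embed f i ℤ.+ embed h i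
embed-⊕ f h (+ n) = refl
embed-⊕ f h -[1+ n ] = refl

embed-ΣPS : ∀ N (f : ℕ → PS) (h : ℕ → ℤ) i → h 0 ≡ + 0 →
  (∀ n → suc n ≤ N → embed (f (suc n)) i ≡ h (suc n)) → embed (ΣPS N f) i ≡ sumTo N h
embed-ΣPS zero f h (+ n) h₀ _ = sym h₀
embed-ΣPS zero f h -[1+ n ] h₀ _ = sym h₀
embed-ΣPS (suc N) f h i h₀ eq = trans (embed-⊕ (ΣPS N f) (f (suc N)) i)
  (cong₂ ℤ._+_ (embed-ΣPS N f h i h₀ (λ n n<N → eq n (ℕₚ.m≤n⇒m≤1+n n<N))) (eq N ℕₚ.≤-refl))

embed-mono : ∀ e f i → embed f (i ℤ.- + e) ≡ embed (mono e ⊗ f) i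
embed-mono e f (+ n) with e ℕ.≤? n
... | yes e≤n = trans (cong (embed f) (trans (ℤₚ.m-n≡m⊖n n e) (ℤₚ.⊖-≥ e≤n))) (sym (mono-⊗-≥ e f n e≤n))
... | no e≰n with ℕₚ.m≤n⇒∃[o]m+o≡n (ℕₚ.≰⇒> e≰n)
... | o , refl = trans (cong (embed f) (ZS.solve 2 (λ n o → n ZS.:- (ZS.con (+ 1) ZS.:+ (n ZS.:+ o)) ZS.:= ZS.:- (ZS.con (+ 1) ZS.:+ o)) refl (+ n) (+ o)))
  (sym (mono-⊗-< (suc n ℕ.+ o) f n (ℕₚ.m≤m+n (suc n) o)))
embed-mono zero f -[1+ n ] = refl
embed-mono (suc e) f -[1+ n ] = refl

∑-filter : ∀ {A : Set} {P : A → Set} (P? : Decidable P) (f : A → ℤ) xs →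
  ∑ f (filter P? xs) ≡ ∑ (λ x → if does (P? x) then f x else + 0) xs
∑-filter P? f [] = refl
∑-filter P? f (x ∷ xs) with does (P? x)
... | true = cong (ℤ._+_ (f x)) (∑-filter P? f xs)
... | false = trans (∑-filter P? f xs) (sym (ℤₚ.+-identityˡ _))

sumLS-∑ : ∀ {A : Set} (f : A → LS) xs i → sumLS (map f xs) i ≡ ∑ (λ x → f x i) xs
sumLS-∑ f [] i = refl
sumLS-∑ f (x ∷ xs) i = cong (ℤ._+_ (f x i)) (sumLS-∑ f xs i)

-- The common factor of the terms n and -n of the bilateral sum, which multiply it by
-- q^{n(n+1)/2+νn} and q^{n(n-1)/2+νn}.
core : ℕ → ℕ → ℕ → PS
core ν N n = qpoch N ⊗ cst (sgn (n ℕ.∸ 1)) ⊗ inv (qpoch (N ℕ.+ n)) ⊗ inv (qpoch (N ℕ.∸ n)) ⊗ inv (oneMinusQ n ^PS (2 ℕ.* ν))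

rightTerm-pos : ∀ ν N k → suc k ≤ N → ∀ i →
  rightTerm ν N (+ suc k) i ≡ embed (mono (tri (suc k) ℕ.+ suc k ℕ.+ ν ℕ.* suc k) ⊗ core ν N (suc k)) i
rightTerm-pos ν N k k<N i = trans
  (cong₂ embed
    (cong₂ (λ s t → qpoch N ⊗ cst s ⊗ inv (qpoch (N ℕ.+ suc k)) ⊗ inv (qpoch t) ⊗ inv (oneMinusQ (suc k) ^PS (2 ℕ.* ν)))
      refl (trans (cong ℤ.∣_∣ (ℤₚ.m-n≡m⊖n N (suc k))) (cong ℤ.∣_∣ (ℤₚ.⊖-≥ k<N))))
    (cong (λ e → i ℤ.- e) expo))
  (embed-mono (tri (suc k) ℕ.+ suc k ℕ.+ ν ℕ.* suc k) (core ν N (suc k)) i)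
  where
  expo : (+ suc k ℤ.* (+ suc k ℤ.+ + 1)) ℤ./ℕ 2 ℤ.+ + ν ℤ.* + suc k ≡ + (tri (suc k) ℕ.+ suc k ℕ.+ ν ℕ.* suc k)
  expo = cong₂ ℤ._+_
    (trans (cong (ℤ._/ℕ 2) (trans (sym (ℤₚ.pos-* (suc k) (suc k ℕ.+ 1))) (cong +_ (trans (ℕₚ.*-comm (suc k) (suc k ℕ.+ 1)) (cong (ℕ._* suc k) (ℕₚ.+-comm (suc k) 1))))))
      (cong +_ (tri-half (suc (suc k)))))
    (sym (ℤₚ.pos-* ν (suc k)))

rightTerm-neg : ∀ ν N k → suc k ≤ N → ∀ i →
  rightTerm ν N -[1+ k ] i ≡ embed (mono (tri (suc k) ℕ.+ ν ℕ.* suc k) ⊗ core ν N (suc k)) i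
rightTerm-neg ν N k k<N i = trans
  (trans
    (cong₂ embed refl expo)
    (embed-cong (⊗-congʳ (inv (oneMinusQ (suc k) ^PS (2 ℕ.* ν))) reorder) (i ℤ.- + (tri (suc k) ℕ.+ ν ℕ.* suc k))))
  (embed-mono (tri (suc k) ℕ.+ ν ℕ.* suc k) (core ν N (suc k)) i)
  where
  open PSolver
  reorder : qpoch N ⊗ cst (sgnℤ -[1+ k ]) ⊗ inv (qpoch ℤ.∣ + N ℤ.+ -[1+ k ] ∣) ⊗ inv (qpoch ℤ.∣ + N ℤ.- -[1+ k ] ∣)
    ≈ qpoch N ⊗ cst (sgn k) ⊗ inv (qpoch (N ℕ.+ suc k)) ⊗ inv (qpoch (N ℕ.∸ suc k))
  reorder = ≈-trans
    (≈-reflexive (cong₂ (λ s t → qpoch N ⊗ cst s ⊗ inv (qpoch t) ⊗ inv (qpoch (N ℕ.+ suc k)))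
      (trans (cong (λ t → sgn (suc (suc t))) (ℕₚ.+-identityʳ k)) (ℤₚ.neg-involutive (sgn k))) (cong ℤ.∣_∣ (ℤₚ.⊖-≥ k<N))))
    (solve 4 (λ a b c e → a :* b :* c :* e := a :* b :* e :* c) ≈-refl
      (qpoch N) (cst (sgn k)) (inv (qpoch (N ℕ.∸ suc k))) (inv (qpoch (N ℕ.+ suc k))))
  half : (-[1+ k ] ℤ.* (-[1+ k ] ℤ.+ + 1)) ℤ./ℕ 2 ≡ + tri (suc k)
  half = trans (cong (ℤ._/ℕ 2) (trans
      (ZS.solve 1 (λ k → (ZS.:- (ZS.con (+ 1) ZS.:+ k)) ZS.:* ((ZS.:- (ZS.con (+ 1) ZS.:+ k)) ZS.:+ ZS.con (+ 1)) ZS.:= (ZS.con (+ 1) ZS.:+ k) ZS.:* k) refl (+ k))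
      (sym (ℤₚ.pos-* (suc k) k))))
    (cong +_ (tri-half (suc k)))
  expo : i ℤ.- ((-[1+ k ] ℤ.* (-[1+ k ] ℤ.+ + 1)) ℤ./ℕ 2 ℤ.+ + ν ℤ.* -[1+ k ]) ℤ.- + (2 ℕ.* ν ℕ.* suc k)
    ≡ i ℤ.- + (tri (suc k) ℕ.+ ν ℕ.* suc k)
  expo = trans
    (cong₂ (λ h e → i ℤ.- (h ℤ.+ + ν ℤ.* -[1+ k ]) ℤ.- e) half
      (trans (ℤₚ.pos-* (2 ℕ.* ν) (suc k)) (cong (ℤ._* + suc k) (ℤₚ.pos-* 2 ν))))
    (trans (ZS.solve 4 (λ i t n k → i ZS.:- (t ZS.:+ n ZS.:* (ZS.:- k)) ZS.:- ZS.con (+ 2) ZS.:* n ZS.:* k ZS.:= i ZS.:- (t ZS.:+ n ZS.:* k)) refl i (+ tri (suc k)) (+ ν) (+ suc k))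
      (cong (λ e → i ℤ.- (+ tri (suc k) ℤ.+ e)) (sym (ℤₚ.pos-* ν (suc k)))))

-- In 1 + qⁿ the summand qⁿ raises n(n-1)/2 to n(n+1)/2 and gives the term at n; the summand 1 gives
-- the term at -n.
middleTerm-split : ∀ ν N n → qpoch N ⊗ middleTerm ν N n ≈
  mono (tri n ℕ.+ n ℕ.+ ν ℕ.* n) ⊗ core ν N n ⊕ mono (tri n ℕ.+ ν ℕ.* n) ⊗ core ν N n
middleTerm-split ν N n = begin
  p ⊗ middleTerm ν N n
    ≈⟨ ⊗-congˡ p (⊗-congʳ I (⊗-congʳ i₂ (⊗-congʳ i₁ (⊗-congʳ (cst (+ 1) ⊕ x) (⊗-congˡ s (middleTerm-mono ν n)))))) ⟩
  p ⊗ (s ⊗ (τ ⊗ M) ⊗ (cst (+ 1) ⊕ x) ⊗ i₁ ⊗ i₂ ⊗ I)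
    ≈⟨ solve 8 (λ p s τ m x i k z → p :* (s :* (τ :* m) :* (con (+ 1) :+ x) :* i :* k :* z)
         := (τ :* x :* m) :* (p :* s :* i :* k :* z) :+ (τ :* m) :* (p :* s :* i :* k :* z)) ≈-refl p s τ M x i₁ i₂ I ⟩
  (τ ⊗ x ⊗ M) ⊗ core ν N n ⊕ (τ ⊗ M) ⊗ core ν N n
    ≈⟨ ⊕-cong (⊗-congʳ (core ν N n) (≈-trans (mono-+ (tri n ℕ.+ n) (ν ℕ.* n)) (⊗-congʳ M (mono-+ (tri n) n))))
         (⊗-congʳ (core ν N n) (mono-+ (tri n) (ν ℕ.* n))) ⟨
  mono (tri n ℕ.+ n ℕ.+ ν ℕ.* n) ⊗ core ν N n ⊕ mono (tri n ℕ.+ ν ℕ.* n) ⊗ core ν N n ∎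
  where
  open ≈-Reasoning
  open PSolver
  p = qpoch N
  s = cst (sgn (n ℕ.∸ 1))
  τ = mono (tri n)
  x = mono n
  M = mono (ν ℕ.* n)
  i₁ = inv (qpoch (N ℕ.+ n))
  i₂ = inv (qpoch (N ℕ.∸ n))
  I = inv (oneMinusQ n ^PS (2 ℕ.* ν))

middle-right : ∀ ν N i → embed (middleSeries ν N) i ≡ rightSeries ν N i
middle-right ν N i = begin
  embed (middleSeries ν N) i
    ≡⟨ embed-cong (≈-sym (ΣPS-⊗ˡ N (qpoch N) (middleTerm ν N))) i ⟩
  embed (ΣPS N (λ n → qpoch N ⊗ middleTerm ν N n)) i
    -- The `refl` is the excluded index 0, where `F` is 0.
    ≡⟨ embed-ΣPS N (λ n → qpoch N ⊗ middleTerm ν N n) (fold± F) i refl term ⟩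
  sumTo N (fold± F)
    ≡⟨ ∑-rangeℤ N F ⟨
  ∑ F (rangeℤ (ℤ.- + N) (+ N))
    ≡⟨ ∑-filter nonzero? (λ n → rightTerm ν N n i) (rangeℤ (ℤ.- + N) (+ N)) ⟨
  ∑ (λ n → rightTerm ν N n i) (nonzeroRange N)
    ≡⟨ sumLS-∑ (rightTerm ν N) (nonzeroRange N) i ⟨
  rightSeries ν N i ∎
  where
  open ≡-Reasoning
  nonzero? : Decidable (λ (n : ℤ) → ¬ n ≡ + 0)
  nonzero? n = ¬? (n ℤ.≟ + 0)
  F : ℤ → ℤ
  F n = if does (nonzero? n) then rightTerm ν N n i else + 0
  term : ∀ k → suc k ≤ N → embed (qpoch N ⊗ middleTerm ν N (suc k)) i ≡ rightTerm ν N (+ suc k) i ℤ.+ rightTerm ν N -[1+ k ] i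
  term k k<N = trans (embed-cong (middleTerm-split ν N (suc k)) i) (trans (embed-⊕ _ _ i)
    (sym (cong₂ ℤ._+_ (rightTerm-pos ν N k k<N i) (rightTerm-neg ν N k k<N i))))

theorem2p4 : (N ν : ℕ) → .{{NonZero N}} → .{{NonZero ν}} →
    ((n : ℕ) → lhsSeries ν N n ≡ middleSeries ν N n)
    × ((i : ℤ) → embed (middleSeries ν N) i ≡ rightSeries ν N i)
theorem2p4 (suc N) (suc v) = lhs-middle v N , middle-right (suc v) (suc N)
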